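{- Let $n$ be a positive integer and let $A_1, A_2$ be sets of integers such that both are MSTD, $A_1$ is $P_n$ and $A_2$ is $P_{n-4}$. Suppose also that: (1) $A_1\cap A_2=\emptyset$ and $A_1\cup A_2=[1,2n]$; (2) $A_i=L_i\cup R_i$ with $L_i\subseteq[1,n]$ and $R_i\subseteq[n+1,2n]$ for $i=1,2$; (3) $[1,4]\cup\{n\}\subseteq L_1$ and $\{n+1\}\cup[2n-3,2n]\subseteq R_1$; (4) $[5,7]\subseteq L_2$ and $[2n-6,2n-4]\subseteq R_2$. Pick an integer $k\ge n/2+2$ and an integer $m\ge 0$. Set $R_1'=R_1+m+4k+4$, $R_2'=R_2+m+4k+4$, $O_{11}=\{n+4\}\cup[n+5,n+2k+1]_2\cup\{n+2k+2\}$, $O_{12}=\{n+m+2k+3\}\cup[n+m+2k+4,n+m+4k]_2\cup\{n+m+4k+1\}$, $O_{21}=[n+1,n+3]\cup[n+6,n+2k]_2\cup[n+2k+3,n+2k+5]$, $O_{22}=[n+m+2k,n+m+2k+2]\cup[n+m+2k+5,n+m+4k-1]_2\cup[n+m+4k+2,n+m+4k+4]$. Let $M_1\subseteq[n+2k+6,n+m+2k-1]$ be such that within $M_1$ there exists a sequence of pairs of consecutive integers $\{x_1,x_1+1\},\dots,\{x_t,x_t+1\}\subseteq M_1$ with $x_1<\dots<x_t$, where consecutive pairs in the sequence are not more than $2k-1$ apart (i.e. $x_{j+1}-x_j\le 2k-1$), the first pair lies in $[n+2k+6,n+4k+1]$ and the last pair lies in $[n+m+4,n+m+2k-1]$. Let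 $M_2\subseteq[n+2k+6,n+m+2k-1]$ be such that within $M_2$ there exists a sequence of triplets of consecutive integers $\{y_1,y_1+1,y_1+2\},\dots,\{y_s,y_s+1,y_s+2\}\subseteq M_2$ with $y_1<\dots<y_s$, where consecutive triplets in the sequence are not more than $2k+5$ apart (i.e. $y_{j+1}-y_j\le 2k+5$), the first triplet lies in $[n+2k+6,n+4k+5]$ and the last triplet lies in $[n+m,n+m+2k-1]$. Suppose moreover $M_1\cap M_2=\emptyset$ and $M_1\cup M_2=[n+2k+6,n+m+2k-1]$. Then $A_1'=L_1\cup O_{11}\cup M_1\cup O_{12}\cup R_1'$ and $A_2'=L_2\cup O_{21}\cup M_2\cup O_{22}\cup R_2'$ are both MSTD and they partition $[1,2n+m+4k+4]$.
   Context: For integers $a\le b$, $[a,b]=\{\ell\in\mathbb{Z}: a\le\ell\le b\}$ and $[a,b]_2=\{\ell\in\mathbb{Z}: a\le \ell\le b,\ \ell-a \text{ even}\}$. For a set $A$ of integers, $A+A=\{x+y:x,y\in A\}$, $A-A=\{x-y:x,y\in A\}$, and $A+t=\{x+t:x\in A\}$. A finite set $A$ is MSTD (more-sums-than-differences) if $|A+A|>|A-A|$. A finite set $A$ with $a=\min A$, $b=\max A$ is $P_n$ if $A+A\supseteq[2a+n,2b-n]$ and $A-A\supseteq[(a-b)+n,(b-a)-n]$. -}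

module Defs where

open import Data.Nat as ℕ using (ℕ; zero; suc)
open import Data.Integer using (ℤ; +_; -[1+_]; _+_; _-_; _*_; _≤_; _<_)
open import Data.Integer.Properties using (_≟_)
open import Data.List using (List; []; _∷_; map; length; deduplicate; cartesianProductWith; applyUpTo)
open import Data.List.Membership.Propositional using (_∈_)
open import Data.Product using (_×_)

-- Finite sets of integers are represented by lists (duplicates allowed);
-- membership is list membership, cardinality counts distinct elements.
ZSet : Set
ZSet = List ℤ

card : ZSet → ℕ
card A = length (deduplicate _≟_ A)

sumset : ZSet → ZSet
sumset A = cartesianProductWith _+_ A A

diffset : ZSet → ZSet
diffset A = cartesianProductWith _-_ A A

shift : ZSet → ℤ → ZSet
shift A t = map (λ x → x + t) A

MSTD : ZSet → Set
MSTD A = card (diffset A) ℕ.< card (sumset A)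

InI : ℤ → ℤ → ℤ → Set
InI x a b = a ≤ x × x ≤ b

interval : ℤ → ℤ → ZSet
interval a b with b - a
... | + d = applyUpTo (λ i → a + + i) (suc d)
... | -[1+ _ ] = []

interval2 : ℤ → ℤ → ZSet
interval2 a b with b - a
... | + d = applyUpTo (λ i → a + + (2 ℕ.* i)) (suc (d ℕ./ 2))
... | -[1+ _ ] = []

IsP : ℤ → ZSet → Set
IsP n A = ∀ a b → a ∈ A → b ∈ A → (∀ x → x ∈ A → InI x a b) →
  (∀ x → InI x (+ 2 * a + n) (+ 2 * b - n) → x ∈ sumset A) ×
  (∀ x → InI x ((a - b) + n) ((b - a) - n) → x ∈ diffset A)

{-# OPTIONS --safe #-}
module Submission where

open import Defs
open import Data.Nat as ℕ using (ℕ; zero; suc; z≤n; s≤s)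
import Data.Nat.DivMod as ℕ
import Data.Nat.Properties as ℕₚ
open import Data.Integer using (ℤ; +_; -[1+_]; _+_; _-_; -_; _*_; _≤_; _<_; +≤+)
open import Data.Integer.Properties
  using (_≟_; _≤?_; ≰⇒>; i<j⇒suc[i]≤j; i≤j⇒0≤j-i; 0≤i-j⇒j≤i; i≡j⇒i-j≡0; i-j≡0⇒i≡j; +-comm;
         +-identityˡ; +-identityʳ; +-mono-≤; i≤i+j; ≤-refl; ≤-reflexive; ≤-trans; ≤-antisym; <⇒≤;
         +-injective; drop‿+≤+)
open import Data.Integer.Tactic.RingSolver using (solve)
open import Data.List using (List; []; _∷_; _++_; map; length; applyUpTo; deduplicate)
open import Data.List.Properties
  using (length-map; length-++; length-applyUpTo; length-++-sucʳ; ++-identityʳ)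
open import Data.List.Membership.Propositional using (_∈_; _∉_)
open import Data.List.Membership.Propositional.Properties
  using (∈-map⁺; ∈-map⁻; ∈-++⁺ˡ; ∈-++⁺ʳ; ∈-++⁻; ∈-∃++; ∈-cartesianProductWith⁺;
         ∈-cartesianProductWith⁻; ∈-applyUpTo⁺; ∈-applyUpTo⁻; ∈-deduplicate⁺; ∈-deduplicate⁻)
open import Data.List.Relation.Binary.Subset.Propositional using (_⊆_)
import Data.List.Relation.Unary.All as All
open import Data.List.Relation.Unary.Any using (here; there)
open import Data.List.Relation.Unary.AllPairs using ([]; _∷_)
open import Data.List.Relation.Unary.Unique.Propositional using (Unique)
open import Data.List.Relation.Unary.Unique.DecPropositional.Properties _≟_ using (deduplicate-!)
import Data.List.Relation.Unary.Unique.Propositional.Properties as Unique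
open import Data.Product using (_×_; _,_; Σ; ∃-syntax; proj₁; proj₂)
open import Data.Sum as Sum using (_⊎_; inj₁; inj₂; [_,_]′)
open import Data.Empty using (⊥; ⊥-elim)
open import Function using (_∘_)
open import Function.Bundles using (_⇔_; mk⇔; module Equivalence)
open import Relation.Nullary using (yes; no; contradiction)
open import Relation.Nullary.Decidable using (from-yes)
open import Relation.Binary.PropositionalEquality
  using (_≡_; _≢_; refl; sym; trans; cong; cong₂; subst; subst₂)

open Equivalence

-- Let A be A₁ or A₂, with c = 0 or c = 4 respectively, and S = m + 4k + 4, so
-- that A′ moves the right half R of A by S and fills the middle.  Property P
-- gives A all differences d with |d| < n - c; the other ones are ± (r - l) with
-- l ∈ L and r ∈ R, and correspond to the differences ± (r + S - l) of A′, so
-- |A′ - A′| ≤ |A - A| + 2S.  The sums of A up to n + c + 1 are sums of two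
-- elements of L, those above 3n - c are sums of two elements of R, and A′ has
-- all sums between n + c + 2 and 3n + 2S - c, so |A′ + A′| ≥ |A + A| + 2S.
-- To see that A′ has these sums, note that consecutive elements of O₁₁ and O₁₂
-- differ by at most 2 (those of O₂₁ and O₂₂ by at most 3), so adding a pair
-- (a triple) of consecutive integers to them gives an interval; the pairs
-- (triples) in A′ are close enough to each other for these intervals to overlap.

-- lin c turns an inequality, usually a sum of hypotheses, into another one that
-- it implies with slack c; the ring solver checks the bookkeeping.
lin : ∀ {l r a b} (c : ℕ) → l ≤ r → b - a ≡ r - l + + c → a ≤ b
lin {l} {r} c l≤r e = 0≤i-j⇒j≤i
  (subst (+ 0 ≤_) (sym e) (≤-trans (i≤j⇒0≤j-i l≤r) (i≤i+j (r - l) (+ c))))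

lin-⊥ : ∀ {l r} (c : ℕ) → l ≤ r → l ≡ r + + suc c → ⊥
lin-⊥ {l} {r} c l≤r refl with lin {a = + suc c} {b = + 0} 0 l≤r (solve (r ∷ []))
... | +≤+ ()

lin-≡ : ∀ {l r a b} → r ≡ l → b - a ≡ r - l → b ≡ a
lin-≡ {l} {r} {a} {b} r≡l e = i-j≡0⇒i≡j b a (trans e (i≡j⇒i-j≡0 r≡l))

<⇒+1≤ : ∀ {i j} → i < j → i + + 1 ≤ j
<⇒+1≤ {i} {j} i<j = subst (_≤ j) (+-comm (+ 1) i) (i<j⇒suc[i]≤j i<j)

≤-or-+1≤ : ∀ i j → i ≤ j ⊎ j + + 1 ≤ i
≤-or-+1≤ i j with i ≤? j
... | yes i≤j = inj₁ i≤j
... | no i≰j = inj₂ (<⇒+1≤ (≰⇒> i≰j))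

nonneg : ∀ {i} → + 0 ≤ i → ∃[ d ] i ≡ + d
nonneg {+ d} _ = d , refl

-- Takes the two branches as functions, so that several cuts can be nested inside one term.
case-≤ : ∀ {ℓ} {C : Set ℓ} i j → (i ≤ j → C) → (j + + 1 ≤ i → C) → C
case-≤ i j f g with ≤-or-+1≤ i j
... | inj₁ i≤j = f i≤j
... | inj₂ j<i = g j<i

infixr 5 _⊕_
_⊕_ : ∀ {i j k l} → i ≤ j → k ≤ l → i + k ≤ j + l
_⊕_ = +-mono-≤

-- Comparing cardinalities of finite sets of integers

-- Pigeonhole: one occurrence of the head is deleted from `ys`. The tail does not contain the head,
-- so it still embeds in what remains.
unique-⊆⇒length≤ : ∀ {xs ys : List ℤ} → Unique xs → xs ⊆ ys → length xs ℕ.≤ length ys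
unique-⊆⇒length≤ {[]} _ _ = z≤n
unique-⊆⇒length≤ {x ∷ xs} (x∉xs ∷ xs!) x∷xs⊆ys with ∈-∃++ (x∷xs⊆ys (here refl))
... | as , bs , refl = subst (suc (length xs) ℕ.≤_) (sym (length-++-sucʳ as x bs))
                         (s≤s (unique-⊆⇒length≤ xs! xs⊆as++bs))
  where
  xs⊆as++bs : xs ⊆ as ++ bs
  xs⊆as++bs y∈xs with ∈-++⁻ as (x∷xs⊆ys (there y∈xs))
  ... | inj₁ y∈as = ∈-++⁺ˡ y∈as
  ... | inj₂ (here y≡x) = contradiction (sym y≡x) (All.lookup x∉xs y∈xs)
  ... | inj₂ (there y∈bs) = ∈-++⁺ʳ as y∈bs

segment : ℤ → ℕ → ZSet
segment a d = applyUpTo (λ i → a + + i) d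

∈-segment⁺ : ∀ {a x} {d : ℕ} → a ≤ x → x + + 1 ≤ a + + d → x ∈ segment a d
∈-segment⁺ {a} {x} {d} a≤x x<a+d with nonneg (i≤j⇒0≤j-i a≤x)
... | i , e = subst (_∈ segment a d) (lin-≡ (sym e) (offset (+ i)))
                (∈-applyUpTo⁺ (λ i → a + + i) (drop‿+≤+ (i<d (+ i) (+ d) e x<a+d)))
  where
  offset : ∀ i → a + i - x ≡ i - (x - a)
  offset i = solve (i ∷ a ∷ x ∷ [])
  i<d : ∀ i d → x - a ≡ i → x + + 1 ≤ a + d → + 1 + i ≤ d
  i<d i d refl x<a+d = lin 0 x<a+d (solve (d ∷ a ∷ x ∷ []))

∈-segment⁻ : ∀ {a x} {d : ℕ} → x ∈ segment a d → a ≤ x × x + + 1 ≤ a + + d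
∈-segment⁻ {a} {x} {d} x∈ with ∈-applyUpTo⁻ (λ i → a + + i) x∈
... | i , i<d , refl = i≤i+j a (+ i) , below (+ i) (+ d) (+≤+ i<d)
  where
  below : ∀ i d → + 1 + i ≤ d → a + i + + 1 ≤ a + d
  below i d i<d = lin 0 i<d (solve (i ∷ d ∷ a ∷ []))

-- Stretching cuts X just above τ, moves the two parts apart by a + b and fills
-- the gap, so that exactly a + b elements are added.
module Stretch (τ a b : ℤ) (d : ℕ) (a+b≡d : a + b ≡ + d) where

  move : ℤ → ℤ
  move x with x ≤? τ
  ... | yes _ = x - a
  ... | no _ = x + b

  move-≤ : ∀ {x} → x ≤ τ → move x ≡ x - a
  move-≤ {x} x≤τ with x ≤? τ
  ... | yes _ = refl
  ... | no x≰τ = contradiction x≤τ x≰τ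

  move-> : ∀ {x} → τ + + 1 ≤ x → move x ≡ x + b
  move-> {x} τ<x with x ≤? τ
  ... | yes x≤τ = ⊥-elim (lin-⊥ 0 (τ<x ⊕ x≤τ) (solve (x ∷ τ ∷ [])))
  ... | no _ = refl

  0≤a+b : + 0 ≤ a + b
  0≤a+b = subst (+ 0 ≤_) (sym a+b≡d) (+≤+ z≤n)

  -- The lower part is moved to values at most τ - a, the upper part to values above τ + b, and τ -
  -- a ≤ τ + b because a + b = d is a natural number.
  separated : ∀ {x y} → x ≤ τ → τ + + 1 ≤ y → x - a ≢ y + b
  separated {x} {y} x≤τ τ<y e =
    lin-⊥ 0 (x≤τ ⊕ τ<y ⊕ ≤-reflexive (sym e) ⊕ 0≤a+b) (solve (τ ∷ x ∷ y ∷ a ∷ b ∷ []))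

  move-injective : ∀ {x y} → move x ≡ move y → x ≡ y
  move-injective {x} {y} e with ≤-or-+1≤ x τ | ≤-or-+1≤ y τ
  ... | inj₁ x≤τ | inj₁ y≤τ rewrite move-≤ x≤τ | move-≤ y≤τ = lin-≡ e (solve (x ∷ y ∷ a ∷ []))
  ... | inj₂ τ<x | inj₂ τ<y rewrite move-> τ<x | move-> τ<y = lin-≡ e (solve (x ∷ y ∷ b ∷ []))
  ... | inj₁ x≤τ | inj₂ τ<y rewrite move-≤ x≤τ | move-> τ<y = ⊥-elim (separated x≤τ τ<y e)
  ... | inj₂ τ<x | inj₁ y≤τ rewrite move-> τ<x | move-≤ y≤τ = ⊥-elim (separated y≤τ τ<x (sym e))

  -- These are the d = a + b integers from τ - a + 1 to τ + b, which lie between the two moved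
  -- parts.
  gap : ZSet
  gap = segment (τ - a + + 1) d

  ∈-gap⁺ : ∀ {y} → τ - a + + 1 ≤ y → y ≤ τ + b → y ∈ gap
  ∈-gap⁺ {y} lo hi = ∈-segment⁺ lo
    (subst (λ d → y + + 1 ≤ τ - a + + 1 + d) a+b≡d (lin 0 hi (solve (τ ∷ a ∷ b ∷ y ∷ []))))

  ∈-gap⁻ : ∀ {y} → y ∈ gap → τ - a + + 1 ≤ y × y ≤ τ + b
  ∈-gap⁻ {y} y∈gap with ∈-segment⁻ y∈gap
  ... | lo , hi = lo , lin 0 (subst (λ d → y + + 1 ≤ τ - a + + 1 + d) (sym a+b≡d) hi)
                         (solve (τ ∷ a ∷ b ∷ y ∷ []))

  stretch : ZSet → ZSet
  stretch X = map move X ++ gap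

  length-stretch : ∀ X → length (stretch X) ≡ length X ℕ.+ d
  length-stretch X = trans (length-++ (map move X))
    (cong₂ ℕ._+_ (length-map move X) (length-applyUpTo _ d))

  stretch-! : ∀ {X} → Unique X → Unique (stretch X)
  stretch-! {X} X! = Unique.++⁺ (Unique.map⁺ move-injective X!)
    (Unique.applyUpTo⁺₁ _ d λ {i} {j} i<j _ e →
      ℕₚ.<⇒≢ i<j (+-injective (lin-≡ e (cancel (τ - a + + 1) (+ i) (+ j)))))
    disjoint
    where
    cancel : ∀ c i j → i - j ≡ (c + i) - (c + j)
    cancel c i j = solve (c ∷ i ∷ j ∷ [])
    disjoint : ∀ {y} → y ∈ map move X × y ∈ gap → ⊥
    disjoint (y∈ , y∈gap) with ∈-map⁻ move y∈
    ... | x , _ , refl with ∈-gap⁻ y∈gap | ≤-or-+1≤ x τ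
    ... | lo , _ | inj₁ x≤τ rewrite move-≤ x≤τ =
      lin-⊥ 0 (lo ⊕ x≤τ) (solve (τ ∷ a ∷ x ∷ []))
    ... | _ , hi | inj₂ τ<x rewrite move-> τ<x =
      lin-⊥ 0 (hi ⊕ τ<x) (solve (τ ∷ b ∷ x ∷ []))

  -- After removal of duplicates, the stretched X is a duplicate-free list with d more entries than
  -- X has elements. The three hypotheses place its lower part, upper part and gap in Y.
  card+≤card : ∀ X Y →
    (∀ {x} → x ∈ X → x ≤ τ → x - a ∈ Y) →
    (∀ {x} → x ∈ X → τ + + 1 ≤ x → x + b ∈ Y) →
    (∀ {y} → τ - a + + 1 ≤ y → y ≤ τ + b → y ∈ Y) →
    card X ℕ.+ d ℕ.≤ card Y
  card+≤card X Y low high mid = subst (ℕ._≤ card Y) (length-stretch X′)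
    (unique-⊆⇒length≤ (stretch-! (deduplicate-! X)) (∈-deduplicate⁺ _≟_ ∘ stretch-⊆))
    where
    X′ = deduplicate _≟_ X
    stretch-⊆ : stretch X′ ⊆ Y
    stretch-⊆ y∈ with ∈-++⁻ (map move X′) y∈
    ... | inj₂ y∈gap = mid (proj₁ (∈-gap⁻ y∈gap)) (proj₂ (∈-gap⁻ y∈gap))
    ... | inj₁ y∈map with ∈-map⁻ move y∈map
    ... | x , x∈X′ , refl with ≤-or-+1≤ x τ
    ... | inj₁ x≤τ = subst (_∈ Y) (sym (move-≤ x≤τ)) (low (∈-deduplicate⁻ _≟_ X x∈X′) x≤τ)
    ... | inj₂ τ<x = subst (_∈ Y) (sym (move-> τ<x)) (high (∈-deduplicate⁻ _≟_ X x∈X′) τ<x)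

  -- Conversely, Y embeds in the stretched X: what lies outside the gap moves back into X, and at
  -- most d elements of Y lie inside it.
  card≤card+ : ∀ X Y →
    (∀ {y} → y ∈ Y → y ≤ τ - a → y + a ∈ X) →
    (∀ {y} → y ∈ Y → τ + b + + 1 ≤ y → y - b ∈ X) →
    card Y ℕ.≤ card X ℕ.+ d
  card≤card+ X Y low high = subst (card Y ℕ.≤_) (length-stretch X′)
    (unique-⊆⇒length≤ (deduplicate-! Y) (⊆-stretch ∘ ∈-deduplicate⁻ _≟_ Y))
    where
    X′ = deduplicate _≟_ X
    moved : ∀ {x y} → x ∈ X → move x ≡ y → y ∈ stretch X′
    moved x∈X refl = ∈-++⁺ˡ (∈-map⁺ move (∈-deduplicate⁺ _≟_ x∈X))
    ⊆-stretch : Y ⊆ stretch X′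
    ⊆-stretch {y} y∈Y with ≤-or-+1≤ y (τ - a) | ≤-or-+1≤ y (τ + b)
    ... | inj₁ y≤ | _ = moved {y = y} (low y∈Y y≤)
      (trans (move-≤ {y + a} (lin 0 y≤ (solve (τ ∷ a ∷ y ∷ [])))) (solve (y ∷ a ∷ [])))
    ... | inj₂ _ | inj₂ <y = moved {y = y} (high y∈Y <y)
      (trans (move-> {y - b} (lin 0 <y (solve (τ ∷ b ∷ y ∷ [])))) (solve (y ∷ b ∷ [])))
    ... | inj₂ lo | inj₁ hi = ∈-++⁺ʳ (map move X′) (∈-gap⁺ lo hi)

-- Reduction to the sums of the extended set

∈-sumset⁺ : ∀ {A} x y z → x ∈ A → y ∈ A → z ≡ x + y → z ∈ sumset A
∈-sumset⁺ _ _ _ x∈A y∈A refl = ∈-cartesianProductWith⁺ _+_ x∈A y∈A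

∈-diffset⁺ : ∀ {A} x y z → x ∈ A → y ∈ A → z ≡ x - y → z ∈ diffset A
∈-diffset⁺ _ _ _ x∈A y∈A refl = ∈-cartesianProductWith⁺ _-_ x∈A y∈A

-- 2n and 3n are written as sums because with-abstraction unfolds the products
-- + 2 * n and + 3 * n to terms that the ring solver cannot read.
MSTD-insert-middle : (n c S : ℤ) → + 0 ≤ S → c + + 1 ≤ n → (A L R A′ : ZSet) →
  L ⊆ A → R ⊆ A → (∀ {x} → x ∈ A → x ∈ L ⊎ x ∈ R) →
  (∀ {x} → x ∈ A → InI x (c + + 1) (n + n - c)) →
  (∀ {x} → x ∈ L → x ≤ n) → (∀ {x} → x ∈ R → n + + 1 ≤ x) →
  (∀ x → InI x (c + + 1 - n) (n - c - + 1) → x ∈ diffset A) →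
  (∀ {x} → x ∈ A′ → InI x (c + + 1) (n + n + S - c)) →
  L ⊆ A′ → (∀ {x} → x ∈ R → x + S ∈ A′) →
  (∀ {x} → x ∈ A′ → x ≤ n → x ∈ L) → (∀ {x} → x ∈ A′ → n + S + + 1 ≤ x → x - S ∈ R) →
  (∀ x → InI x (n + c + + 2) (n + n + n + S + S - c) → x ∈ sumset A′) →
  MSTD A → MSTD A′
MSTD-insert-middle n c S 0≤S c<n A L R A′ L⊆A R⊆A A⊆L⊎R A-bounds L≤n n<R A-diffs
  A′-bounds L⊆A′ R+S⊆A′ A′⊆L A′-S⊆R A′-sums mstd with nonneg (0≤S ⊕ 0≤S)
... | d , S+S≡d =
  ℕₚ.≤-<-trans (Diffs.card≤card+ (diffset A) (diffset A′) diff-low diff-high)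
    (ℕₚ.<-≤-trans (ℕₚ.+-monoˡ-< d mstd)
      (Sums.card+≤card (sumset A) (sumset A′) sum-low sum-high sum-mid))
  where
  -- One cut serves both ends: differences up to c - n move down by S, and all others move up by S,
  -- including the full block from c + 1 - n to n - c - 1.
  module Diffs = Stretch (c - n) S S d S+S≡d
  -- Sums up to n + c + 1 come from L and stay in place; the others move up by 2S.
  module Sums = Stretch (n + c + + 1) (+ 0) (S + S) d (trans (+-identityˡ (S + S)) S+S≡d)

  small⇒∈L : ∀ {x} → x ∈ A → x ≤ n → x ∈ L
  small⇒∈L {x} x∈A x≤n with A⊆L⊎R x∈A
  ... | inj₁ x∈L = x∈L
  ... | inj₂ x∈R = ⊥-elim (lin-⊥ 0 (n<R x∈R ⊕ x≤n) (solve (n ∷ x ∷ [])))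

  large⇒∈R : ∀ {x} → x ∈ A → n + + 1 ≤ x → x ∈ R
  large⇒∈R {x} x∈A n<x with A⊆L⊎R x∈A
  ... | inj₂ x∈R = x∈R
  ... | inj₁ x∈L = ⊥-elim (lin-⊥ 0 (L≤n x∈L ⊕ n<x) (solve (n ∷ x ∷ [])))

  sum-low : ∀ {x} → x ∈ sumset A → x ≤ n + c + + 1 → x - + 0 ∈ sumset A′
  sum-low x∈ x≤ with ∈-cartesianProductWith⁻ _+_ A A x∈
  -- Each summand is at least c + 1, so the other one is at most n and lies in L.
  ... | y , z , y∈A , z∈A , refl = ∈-sumset⁺ y z (y + z - + 0)
    (L⊆A′ (small⇒∈L y∈A (lin 0 (x≤ ⊕ proj₁ (A-bounds z∈A)) (solve (n ∷ c ∷ y ∷ z ∷ [])))))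
    (L⊆A′ (small⇒∈L z∈A (lin 0 (x≤ ⊕ proj₁ (A-bounds y∈A)) (solve (n ∷ c ∷ y ∷ z ∷ [])))))
    (solve (y ∷ z ∷ []))

  sum-high : ∀ {x} → x ∈ sumset A → n + c + + 1 + + 1 ≤ x → x + (S + S) ∈ sumset A′
  sum-high {x} x∈ <x with ≤-or-+1≤ x (n + n + n - c) | ∈-cartesianProductWith⁻ _+_ A A x∈
  ... | inj₁ x≤ | _ = A′-sums (x + (S + S))
    ( lin 0 (<x ⊕ 0≤S ⊕ 0≤S) (solve (n ∷ c ∷ x ∷ S ∷ []))
    , lin 0 x≤ (solve (n ∷ c ∷ x ∷ S ∷ [])))
  -- Each summand is at most 2n - c, so the other one exceeds n and lies in R.
  ... | inj₂ 3n-c<x | y , z , y∈A , z∈A , refl = ∈-sumset⁺ (y + S) (z + S) (y + z + (S + S))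
    (R+S⊆A′ (large⇒∈R y∈A (lin 0 (3n-c<x ⊕ proj₂ (A-bounds z∈A)) (solve (n ∷ c ∷ y ∷ z ∷ [])))))
    (R+S⊆A′ (large⇒∈R z∈A (lin 0 (3n-c<x ⊕ proj₂ (A-bounds y∈A)) (solve (n ∷ c ∷ y ∷ z ∷ [])))))
    (solve (y ∷ z ∷ S ∷ []))

  sum-mid : ∀ {x} → n + c + + 1 - + 0 + + 1 ≤ x → x ≤ n + c + + 1 + (S + S) → x ∈ sumset A′
  sum-mid {x} lo hi = A′-sums x
    ( lin 0 lo (solve (n ∷ c ∷ x ∷ []))
    , lin 1 (hi ⊕ c<n ⊕ c<n) (solve (n ∷ c ∷ x ∷ S ∷ [])))

  diff-low : ∀ {x} → x ∈ diffset A′ → x ≤ c - n - S → x + S ∈ diffset A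
  diff-low x∈ x≤ with ∈-cartesianProductWith⁻ _-_ A′ A′ x∈
  -- From z ≤ 2n + S - c follows y ≤ n, and from y ≥ c + 1 follows z > n + S. So y comes from L and
  -- z from R + S.
  ... | y , z , y∈A′ , z∈A′ , refl = ∈-diffset⁺ y (z - S) (y - z + S)
    (L⊆A (A′⊆L y∈A′ (lin 0 (x≤ ⊕ proj₂ (A′-bounds z∈A′)) (solve (n ∷ c ∷ S ∷ y ∷ z ∷ [])))))
    (R⊆A (A′-S⊆R z∈A′ (lin 0 (x≤ ⊕ proj₁ (A′-bounds y∈A′)) (solve (n ∷ c ∷ S ∷ y ∷ z ∷ [])))))
    (solve (y ∷ z ∷ S ∷ []))

  diff-high : ∀ {x} → x ∈ diffset A′ → c - n + S + + 1 ≤ x → x - S ∈ diffset A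
  diff-high {x} x∈ <x with ≤-or-+1≤ (x - S) (n - c - + 1) | ∈-cartesianProductWith⁻ _-_ A′ A′ x∈
  ... | inj₁ x-S≤ | _ = A-diffs (x - S) (lin 0 <x (solve (n ∷ c ∷ x ∷ S ∷ [])) , x-S≤)
  ... | inj₂ n-c≤x-S | y , z , y∈A′ , z∈A′ , refl = ∈-diffset⁺ (y - S) z (y - z - S)
    (R⊆A (A′-S⊆R y∈A′ (lin 0 (n-c≤x-S ⊕ proj₁ (A′-bounds z∈A′)) (solve (n ∷ c ∷ S ∷ y ∷ z ∷ [])))))
    (L⊆A (A′⊆L z∈A′ (lin 0 (n-c≤x-S ⊕ proj₂ (A′-bounds y∈A′)) (solve (n ∷ c ∷ S ∷ y ∷ z ∷ [])))))
    (solve (y ∷ z ∷ S ∷ []))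

-- Intervals, parity and two-colourings of an interval

∈-interval⁺ : ∀ a b x → a ≤ x → x ≤ b → x ∈ interval a b
∈-interval⁺ a b x a≤x x≤b with b - a in b-a≡d
... | + d = ∈-segment⁺ a≤x (below (+ d) b-a≡d)
  where
  below : ∀ d → b - a ≡ d → x + + 1 ≤ a + (+ 1 + d)
  below d refl = lin 0 x≤b (solve (a ∷ b ∷ x ∷ []))
... | -[1+ d ] with subst (+ 0 ≤_) b-a≡d (i≤j⇒0≤j-i (≤-trans a≤x x≤b))
... | ()

∈-interval⁻ : ∀ {a b x} → x ∈ interval a b → InI x a b
∈-interval⁻ {a} {b} {x} x∈ with b - a in b-a≡d
... | + d = proj₁ (∈-segment⁻ {a} {d = suc d} x∈) , below (+ d) b-a≡d (proj₂ (∈-segment⁻ {a} {d = suc d} x∈))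
  where
  below : ∀ d → b - a ≡ d → x + + 1 ≤ a + (+ 1 + d) → x ≤ b
  below d refl x<b = lin 0 x<b (solve (a ∷ b ∷ x ∷ []))

+[2*] : ∀ i → + (2 ℕ.* i) ≡ + i + + i
+[2*] i = cong (λ j → + (i ℕ.+ j)) (ℕₚ.+-identityʳ i)

∈-interval2⁺ : ∀ a b x (i : ℕ) → x ≡ a + (+ i + + i) → x ≤ b → x ∈ interval2 a b
∈-interval2⁺ a b _ i refl ≤b with b - a in b-a≡d
... | + d = subst (_∈ _) (cong (λ j → a + j) (+[2*] i))
  (∈-applyUpTo⁺ (λ i → a + + (2 ℕ.* i)) (s≤s i≤d/2))
  where
  below : ∀ i d → b - a ≡ d → a + (i + i) ≤ b → i + i ≤ d
  below i d refl ≤b = lin 0 ≤b (solve (a ∷ b ∷ i ∷ []))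
  i≤d/2 : i ℕ.≤ d ℕ./ 2
  i≤d/2 = subst (ℕ._≤ d ℕ./ 2) (ℕ.m*n/n≡m i 2) (ℕ./-monoˡ-≤ 2
    (subst (ℕ._≤ d) (trans (cong (i ℕ.+_) (sym (ℕₚ.+-identityʳ i))) (ℕₚ.*-comm 2 i))
      (drop‿+≤+ (below (+ i) (+ d) b-a≡d ≤b))))
... | -[1+ d ] with subst (+ 0 ≤_) b-a≡d (above (+ i) (+≤+ {0} {i} z≤n) ≤b)
  where
  above : ∀ i → + 0 ≤ i → a + (i + i) ≤ b → + 0 ≤ b - a
  above i 0≤i ≤b = lin 0 (0≤i ⊕ 0≤i ⊕ ≤b) (solve (a ∷ b ∷ i ∷ []))
... | ()

∈-interval2⁻ : ∀ {a b x} → x ∈ interval2 a b → ∃[ i ] (x ≡ a + (+ i + + i) × x ≤ b)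
∈-interval2⁻ {a} {b} x∈ with b - a in b-a≡d
... | + d with ∈-applyUpTo⁻ (λ i → a + + (2 ℕ.* i)) x∈
... | i , s≤s i≤d/2 , refl = i , cong (λ j → a + j) (+[2*] i) ,
  below (+ (2 ℕ.* i)) (+ d) b-a≡d (+≤+ (ℕₚ.≤-trans (ℕₚ.*-monoʳ-≤ 2 i≤d/2)
    (ℕₚ.≤-trans (ℕₚ.≤-reflexive (ℕₚ.*-comm 2 (d ℕ./ 2))) (ℕ.m/n*n≤m d 2))))
  where
  below : ∀ j d → b - a ≡ d → j ≤ d → a + j ≤ b
  below j d refl j≤d = lin 0 j≤d (solve (a ∷ b ∷ j ∷ []))

parity : ∀ d → ∃[ q ] (+ d ≡ + q + + q ⊎ + d ≡ + q + + q + + 1)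
parity zero = 0 , inj₁ refl
parity (suc d) with parity d
... | q , inj₁ d≡2q = q , inj₂ (trans (cong (λ j → + 1 + j) d≡2q) (comm (+ q)))
  where
  comm : ∀ q → + 1 + (q + q) ≡ q + q + + 1
  comm q = solve (q ∷ [])
... | q , inj₂ d≡2q+1 = suc q , inj₁ (trans (cong (λ j → + 1 + j) d≡2q+1) (comm (+ q)))
  where
  comm : ∀ q → + 1 + (q + q + + 1) ≡ + 1 + q + (+ 1 + q)
  comm q = solve (q ∷ [])

even≢odd : ∀ a i j → a + (i + i) ≢ a + + 1 + (j + j)
even≢odd a i j e = case-≤ i j
      (λ i≤j → lin-⊥ 0 (i≤j ⊕ i≤j ⊕ ≤-reflexive (sym e)) (solve (a ∷ i ∷ j ∷ [])))
      (λ j<i → lin-⊥ 0 (j<i ⊕ j<i ⊕ ≤-reflexive e) (solve (a ∷ i ∷ j ∷ [])))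

offset-parity : ∀ {a} x → a ≤ x → ∃[ q ] (x ≡ a + (+ q + + q) ⊎ x ≡ a + + 1 + (+ q + + q))
offset-parity {a} x a≤x with nonneg (i≤j⇒0≤j-i a≤x)
... | d , x-a≡d with parity d
... | q , inj₁ d≡2q = q , inj₁ (even (+ q) (trans x-a≡d d≡2q))
  where
  even : ∀ q → x - a ≡ q + q → x ≡ a + (q + q)
  even q e = lin-≡ e (solve (a ∷ x ∷ q ∷ []))
... | q , inj₂ d≡2q+1 = q , inj₂ (odd (+ q) (trans x-a≡d d≡2q+1))
  where
  odd : ∀ q → x - a ≡ q + q + + 1 → x ≡ a + + 1 + (q + q)
  odd q e = lin-≡ e (solve (a ∷ x ∷ q ∷ []))

-- Either class may be empty, so that one-coloured intervals can serve as pieces for gluing.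
record Partition (X Y : ZSet) (a b : ℤ) : Set where
  field
    left : ∀ {x} → x ∈ X → InI x a b
    right : ∀ {x} → x ∈ Y → InI x a b
    disjoint : ∀ {x} → x ∈ X → x ∉ Y
    cover : ∀ x → InI x a b → x ∈ X ⊎ x ∈ Y

open Partition

swap : ∀ {X Y a b} → Partition X Y a b → Partition Y X a b
swap p = record
  { left = right p ; right = left p ; disjoint = λ y x → disjoint p x y
  ; cover = λ x x∈ → Sum.swap (cover p x x∈) }

-- Comparison with b decides which piece covers a point, and the ranges of the pieces do not meet.
-- The equation for c lets the endpoints keep the form in which they occur.
glue : ∀ {X Y X′ Y′} a b c d → c ≡ b + + 1 → a ≤ c → b ≤ d →
  Partition X Y a b → Partition X′ Y′ c d → Partition (X ++ X′) (Y ++ Y′) a d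
glue {X} {Y} {X′} {Y′} a b _ d refl a≤c b≤d p q = record
  { left = [ widenˡ ∘ left p , widenʳ ∘ left q ]′ ∘ ∈-++⁻ X
  ; right = [ widenˡ ∘ right p , widenʳ ∘ right q ]′ ∘ ∈-++⁻ Y
  ; disjoint = λ x∈ y∈ → separate (∈-++⁻ X x∈) (∈-++⁻ Y y∈)
  ; cover = λ x x∈ → case-≤ x b
      (λ x≤b → Sum.map ∈-++⁺ˡ ∈-++⁺ˡ (cover p x (proj₁ x∈ , x≤b)))
      (λ b<x → Sum.map (∈-++⁺ʳ X) (∈-++⁺ʳ Y) (cover q x (b<x , proj₂ x∈)))
  }
  where
  widenˡ : ∀ {x} → InI x a b → InI x a d
  widenˡ (a≤x , x≤b) = a≤x , ≤-trans x≤b b≤d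
  widenʳ : ∀ {x} → InI x (b + + 1) d → InI x a d
  widenʳ (b<x , x≤d) = ≤-trans a≤c b<x , x≤d
  clash : ∀ {x} → InI x a b → InI x (b + + 1) d → ⊥
  clash {x} (_ , x≤b) (b<x , _) = lin-⊥ 0 (x≤b ⊕ b<x) (solve (x ∷ b ∷ []))
  separate : ∀ {x} → x ∈ X ⊎ x ∈ X′ → x ∈ Y ⊎ x ∈ Y′ → ⊥
  separate (inj₁ x∈) (inj₁ y∈) = disjoint p x∈ y∈
  separate (inj₁ x∈) (inj₂ y∈) = clash (left p x∈) (right q y∈)
  separate (inj₂ x∈) (inj₁ y∈) = clash (right p y∈) (left q x∈)
  separate (inj₂ x∈) (inj₂ y∈) = disjoint q x∈ y∈

interval-partition : ∀ a b → Partition (interval a b) [] a b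
interval-partition a b = record
  { left = ∈-interval⁻ ; right = λ () ; disjoint = λ _ ()
  ; cover = λ x x∈ → inj₁ (∈-interval⁺ a b x (proj₁ x∈) (proj₂ x∈)) }

adjacent-partition : ∀ a b c d → c ≡ b + + 1 → a ≤ c → b ≤ d →
  Partition (interval a b) (interval c d) a d
adjacent-partition a b c d c≡ a≤c b≤d = subst (λ X → Partition X (interval c d) a d)
  (++-identityʳ (interval a b))
  (glue a b c d c≡ a≤c b≤d (interval-partition a b) (swap (interval-partition c d)))

-- The classes are the even and the odd offsets from a. As b = a + 2e has even offset, the odd class
-- ends at d = b - 1.
interval2-partition : ∀ a b c d e → b ≡ a + (e + e) → c ≡ a + + 1 → b ≡ d + + 1 →
  Partition (interval2 a b) (interval2 c d) a b
interval2-partition a _ _ d e refl refl b≡d+1 = record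
  { left = λ x∈ → evens (∈-interval2⁻ x∈)
  ; right = λ x∈ → odds (∈-interval2⁻ x∈)
  ; disjoint = λ x∈ y∈ → apart (∈-interval2⁻ x∈) (∈-interval2⁻ y∈)
  ; cover = λ x x∈ → classify x x∈ (offset-parity x (proj₁ x∈))
  }
  where
  b = a + (e + e)
  evens : ∀ {x} → ∃[ i ] (x ≡ a + (+ i + + i) × x ≤ b) → InI x a b
  evens (i , refl , x≤b) = i≤i+j a (+ (i ℕ.+ i)) , x≤b
  odds : ∀ {x} → ∃[ i ] (x ≡ a + + 1 + (+ i + + i) × x ≤ d) → InI x a b
  odds (i , refl , x≤d) = ≤-trans (i≤i+j a (+ 1)) (i≤i+j (a + + 1) (+ (i ℕ.+ i))) ,
    ≤-trans x≤d (≤-trans (i≤i+j d (+ 1)) (≤-reflexive (sym b≡d+1)))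
  apart : ∀ {x} → ∃[ i ] (x ≡ a + (+ i + + i) × x ≤ b) → ∃[ i ] (x ≡ a + + 1 + (+ i + + i) × x ≤ d) → ⊥
  apart (i , x≡ , _) (j , x≡′ , _) = even≢odd a (+ i) (+ j) (trans (sym x≡) x≡′)
  odd≤d : ∀ q → a + + 1 + (q + q) ≤ a + (e + e) → a + + 1 + (q + q) ≤ d
  odd≤d q ≤b = case-≤ {C = a + + 1 + (q + q) ≤ d} e q
      (λ e≤q → ⊥-elim (lin-⊥ 0 (e≤q ⊕ e≤q ⊕ ≤b) (solve (a ∷ e ∷ q ∷ []))))
      (λ q<e → lin 0 (q<e ⊕ q<e ⊕ ≤-reflexive b≡d+1) (solve (a ∷ d ∷ e ∷ q ∷ [])))
  classify : ∀ x → InI x a b → ∃[ q ] (x ≡ a + (+ q + + q) ⊎ x ≡ a + + 1 + (+ q + + q)) →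
    x ∈ interval2 a b ⊎ x ∈ interval2 (a + + 1) d
  classify _ (_ , x≤b) (q , inj₁ refl) = inj₁ (∈-interval2⁺ _ _ _ q refl x≤b)
  classify _ (_ , x≤b) (q , inj₂ refl) = inj₂ (∈-interval2⁺ _ _ _ q refl (odd≤d (+ q) x≤b))

-- Windows and blocks

-- The intervals [y, y + w] with P y cover [a, b]; successive points of P may thus be up to w + 1
-- apart.
record Window (w a b : ℤ) (P : ℤ → Set) : Set where
  constructor window
  field
    find : ∀ v → InI v a b → ∃[ y ] (P y × y ≤ v × v ≤ y + w)

open Window

window-point : ∀ {w b P} y → P y → b ≤ y + w → Window w y b P
window-point y Py b≤y+w = window λ v (y≤v , v≤b) → y , Py , y≤v , ≤-trans v≤b b≤y+w

window-glue : ∀ {w a b d P} c → Window w a b P → Window w c d P → c ≤ b + + 1 → Window w a d P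
window-glue {b = b} c W W′ c≤b+1 = window λ v (a≤v , v≤d) → case-≤ v b
  (λ v≤b → find W v (a≤v , v≤b))
  (λ b<v → find W′ v (≤-trans c≤b+1 b<v , v≤d))

window-map : ∀ {w a b P Q} → (∀ {y} → P y → Q y) → Window w a b P → Window w a b Q
window-map f W = window λ v v∈ → let y , Py , bounds = find W v v∈ in y , f Py , bounds

-- The new point b + 1 uses the y found for b, at the price of one more unit of width.
window-grow : ∀ {w a b P} → Window w a b P → a ≤ b → Window (w + + 1) a (b + + 1) P
window-grow {w} {a} {b} {P} W a≤b = window λ v (a≤v , v≤b+1) → case-≤ v b
  (λ v≤b → inside v (find W v (a≤v , v≤b)))
  (λ b<v → beyond v v≤b+1 b<v (find W b (a≤b , ≤-refl)))
  where
  inside : ∀ v → ∃[ y ] (P y × y ≤ v × v ≤ y + w) → ∃[ y ] (P y × y ≤ v × v ≤ y + (w + + 1))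
  inside v (y , Py , y≤v , v≤y+w) = y , Py , y≤v , lin 1 v≤y+w (solve (v ∷ y ∷ w ∷ []))
  beyond : ∀ v → v ≤ b + + 1 → b + + 1 ≤ v → ∃[ y ] (P y × y ≤ b × b ≤ y + w) →
    ∃[ y ] (P y × y ≤ v × v ≤ y + (w + + 1))
  beyond v v≤b+1 b<v (y , Py , y≤b , b≤y+w) = y , Py , lin 1 (y≤b ⊕ b<v) (solve (v ∷ y ∷ b ∷ [])) ,
    lin 0 (v≤b+1 ⊕ b≤y+w) (solve (v ∷ y ∷ b ∷ w ∷ []))

-- With steps of at most w + 1, each interval [xs j, xs j + w] begins no later than one past the end
-- of the previous one.
window-chain : ∀ {w P} (xs : ℕ → ℤ) t → (∀ j → j ℕ.≤ t → P (xs j)) →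
  (∀ j → j ℕ.< t → xs (suc j) ≤ xs j + w + + 1) → Window w (xs 0) (xs t + w) P
window-chain xs zero all _ = window-point (xs 0) (all 0 z≤n) ≤-refl
window-chain xs (suc t) all step = window-glue (xs (suc t))
  (window-chain xs t (λ j j≤t → all j (ℕₚ.m≤n⇒m≤1+n j≤t)) (λ j j<t → step j (ℕₚ.m≤n⇒m≤1+n j<t)))
  (window-point (xs (suc t)) (all (suc t) ℕₚ.≤-refl) ≤-refl)
  (step t ℕₚ.≤-refl)

-- A point at odd offset from a uses its predecessor; so b also serves b + 1.
interval2-window : ∀ a b e → b ≡ a + (e + e) → Window (+ 1) a (b + + 1) (_∈ interval2 a b)
interval2-window a _ e refl = window λ v (a≤v , v≤b+1) → covered v v≤b+1 (offset-parity v a≤v)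
  where
  below : ∀ q → a + (q + q) ≤ a + (e + e) + + 1 → a + (q + q) ≤ a + (e + e)
  below q ≤b+1 = case-≤ {C = a + (q + q) ≤ a + (e + e)} q e
    (λ q≤e → lin 0 (q≤e ⊕ q≤e) (solve (a ∷ e ∷ q ∷ [])))
    (λ e<q → ⊥-elim (lin-⊥ 0 (e<q ⊕ e<q ⊕ ≤b+1) (solve (a ∷ e ∷ q ∷ []))))
  below′ : ∀ q → a + + 1 + (q + q) ≤ a + (e + e) + + 1 → a + (q + q) ≤ a + (e + e)
  below′ q ≤b+1 = lin 0 ≤b+1 (solve (a ∷ e ∷ q ∷ []))
  commute : ∀ q → a + + 1 + (q + q) ≡ a + (q + q) + + 1
  commute q = solve (a ∷ q ∷ [])
  covered : ∀ v → v ≤ a + (e + e) + + 1 → ∃[ q ] (v ≡ a + (+ q + + q) ⊎ v ≡ a + + 1 + (+ q + + q)) →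
    ∃[ y ] (y ∈ interval2 a (a + (e + e)) × y ≤ v × v ≤ y + + 1)
  covered _ v≤b+1 (q , inj₁ refl) =
    a + (+ q + + q) , ∈-interval2⁺ _ _ _ q refl (below (+ q) v≤b+1) , ≤-refl , i≤i+j (a + (+ q + + q)) (+ 1)
  covered _ v≤b+1 (q , inj₂ refl) =
    a + (+ q + + q) , ∈-interval2⁺ _ _ _ q refl (below′ (+ q) v≤b+1) ,
    ≤-trans (i≤i+j (a + (+ q + + q)) (+ 1)) (≤-reflexive (sym (commute (+ q)))) , ≤-reflexive (commute (+ q))

-- The number g counts steps, not elements: pairs have g = 1 and triples g = 2.
Block : ℤ → ZSet → ℤ → Set
Block g A y = ∀ x → InI x y (y + g) → x ∈ A

-- If y is the start of a block with y ≤ s - α ≤ y + w, then s - y lies in the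
-- range of the window of A, and some o ∈ A has s - o in the block.
window+blocks⊆sumset : ∀ {g w α β lo hi A} →
  Window g α β (_∈ A) → Window w lo hi (Block g A) → α + w ≤ β →
  ∀ s → InI s (lo + α) (hi + α) → s ∈ sumset A
window+blocks⊆sumset {g} {w} {α} {β} {lo} {hi} {A} W V α+w≤β s (lo+α≤s , s≤hi+α)
  with find V (s - α) ( lin 0 lo+α≤s (solve (s ∷ lo ∷ α ∷ [])) , lin 0 s≤hi+α (solve (s ∷ hi ∷ α ∷ [])))
... | y , block , y≤s-α , s-α≤y+w
  with find W (s - y) ( lin 0 y≤s-α (solve (s ∷ y ∷ α ∷ []))
                 , lin 0 (s-α≤y+w ⊕ α+w≤β) (solve (s ∷ y ∷ w ∷ α ∷ β ∷ [])))
... | o , o∈A , o≤s-y , s-y≤o+g = ∈-sumset⁺ o (s - o) s o∈A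
  (block (s - o) ( lin 0 o≤s-y (solve (s ∷ y ∷ o ∷ []))
                 , lin 0 s-y≤o+g (solve (s ∷ y ∷ o ∷ g ∷ []))))
  (solve (s ∷ o ∷ []))

pair-block : ∀ {A y} → y ∈ A → y + + 1 ∈ A → Block (+ 1) A y
pair-block {A} {y} y∈A y+1∈A x (y≤x , x≤y+1) = case-≤ x y
  (λ x≤y → subst (_∈ A) (≤-antisym y≤x x≤y) y∈A)
  (λ y<x → subst (_∈ A) (≤-antisym y<x x≤y+1) y+1∈A)

triple-block : ∀ {A y} → y ∈ A → y + + 1 ∈ A → y + + 2 ∈ A → Block (+ 2) A y
triple-block {A} {y} y∈A y+1∈A y+2∈A x (y≤x , x≤y+2) = case-≤ x (y + + 1)
  (λ x≤y+1 → pair-block y∈A y+1∈A x (y≤x , x≤y+1))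
  (λ y+1<x → subst (_∈ A) (≤-antisym (lin {a = y + + 2} {b = x} 0 y+1<x (solve (x ∷ y ∷ []))) x≤y+2) y+2∈A)

-- O₁₁ and O₂₁ are thin p e and thick p e with p = n + 4, e = k - 2, and O₁₂ and
-- O₂₂ are those with p = n + m + 2k + 3, e = k - 2.
thin : ℤ → ℤ → ZSet
thin p e = interval p p ++ interval2 (p + + 1) (p + + 1 + (e + e))
             ++ interval (p + + 2 + (e + e)) (p + + 2 + (e + e))

thick : ℤ → ℤ → ZSet
thick p e = interval (p - + 3) (p - + 1) ++ interval2 (p + + 2) (p + (e + e))
              ++ interval (p + + 3 + (e + e)) (p + + 5 + (e + e))

-- Partition, windows and blocks of the thin and thick sets

0≤0 : + 0 ≤ + 0
0≤0 = ≤-refl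

module _ (p e : ℤ) (1≤e : + 1 ≤ e) where

  0≤e : + 0 ≤ e
  0≤e = ≤-trans (+≤+ z≤n) 1≤e

  -- On the left a thick triple is followed by the thin point p, on the right is the mirror image of
  -- this, and between p + 1 and p + 1 + 2e the classes alternate, with both ends thin.
  thin-thick-partition : Partition (thin p e) (thick p e) (p - + 3) (p + + 5 + (e + e))
  thin-thick-partition =
    glue (p - + 3) p (p + + 1) (p + + 5 + (e + e))
      refl (lin 4 0≤0 (solve (p ∷ []))) (lin 5 (0≤e ⊕ 0≤e) (solve (p ∷ e ∷ [])))
      (swap (adjacent-partition (p - + 3) (p - + 1) p p
        (solve (p ∷ [])) (lin 3 0≤0 (solve (p ∷ []))) (lin 1 0≤0 (solve (p ∷ [])))))
      (glue (p + + 1) (p + + 1 + (e + e)) (p + + 2 + (e + e)) (p + + 5 + (e + e))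
        (solve (p ∷ e ∷ [])) (lin 1 (0≤e ⊕ 0≤e) (solve (p ∷ e ∷ []))) (lin 4 0≤0 (solve (p ∷ e ∷ [])))
        (interval2-partition (p + + 1) (p + + 1 + (e + e)) (p + + 2) (p + (e + e)) e
          refl (solve (p ∷ [])) (solve (p ∷ e ∷ [])))
        (adjacent-partition (p + + 2 + (e + e)) (p + + 2 + (e + e)) (p + + 3 + (e + e)) (p + + 5 + (e + e))
          (solve (p ∷ e ∷ [])) (lin 1 0≤0 (solve (p ∷ e ∷ []))) (lin 3 0≤0 (solve (p ∷ e ∷ [])))))

  private
    thin₁ : interval p p ⊆ thin p e
    thin₁ = ∈-++⁺ˡ

    thin₂ : interval2 (p + + 1) (p + + 1 + (e + e)) ⊆ thin p e
    thin₂ = ∈-++⁺ʳ (interval p p) ∘ ∈-++⁺ˡ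

    thin₃ : interval (p + + 2 + (e + e)) (p + + 2 + (e + e)) ⊆ thin p e
    thin₃ = ∈-++⁺ʳ (interval p p) ∘ ∈-++⁺ʳ (interval2 (p + + 1) (p + + 1 + (e + e)))

    thick₁ : interval (p - + 3) (p - + 1) ⊆ thick p e
    thick₁ = ∈-++⁺ˡ

    thick₂ : interval2 (p + + 2) (p + (e + e)) ⊆ thick p e
    thick₂ = ∈-++⁺ʳ (interval (p - + 3) (p - + 1)) ∘ ∈-++⁺ˡ

    thick₃ : interval (p + + 3 + (e + e)) (p + + 5 + (e + e)) ⊆ thick p e
    thick₃ = ∈-++⁺ʳ (interval (p - + 3) (p - + 1)) ∘ ∈-++⁺ʳ (interval2 (p + + 2) (p + (e + e)))

    first : p ∈ thin p e
    first = thin₁ (∈-interval⁺ p p p ≤-refl ≤-refl)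

    last : p + + 2 + (e + e) ∈ thin p e
    last = thin₃ (∈-interval⁺ (p + + 2 + (e + e)) (p + + 2 + (e + e)) (p + + 2 + (e + e)) ≤-refl ≤-refl)

    second : p + + 1 ∈ thin p e
    second = thin₂ (∈-interval2⁺ (p + + 1) (p + + 1 + (e + e)) (p + + 1) 0
      (sym (+-identityʳ (p + + 1))) (lin 0 (0≤e ⊕ 0≤e) (solve (p ∷ e ∷ []))))

  last-but-one : ∀ {q} → e ≡ + q → p + + 1 + (e + e) ∈ interval2 (p + + 1) (p + + 1 + (e + e))
  last-but-one {q} refl = ∈-interval2⁺ (p + + 1) _ _ q refl ≤-refl

  -- Consecutive elements are at most 2 apart, and the last one, p + 2 + 2e, covers one further
  -- point.
  thin-window : Window (+ 1) p (p + + 3 + (e + e)) (_∈ thin p e)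
  thin-window =
    window-glue (p + + 1)
      (window-point p first ≤-refl)
      (window-glue (p + + 2 + (e + e))
        (window-map thin₂ (interval2-window (p + + 1) (p + + 1 + (e + e)) e refl))
        (window-point (p + + 2 + (e + e)) last (≤-reflexive (solve (p ∷ e ∷ []))))
        (lin 1 0≤0 (solve (p ∷ e ∷ []))))
      (lin 1 0≤0 (solve (p ∷ [])))

  thin-block₁ : Block (+ 1) (thin p e) p
  thin-block₁ = pair-block first second

  thin-block₂ : Block (+ 1) (thin p e) (p + + 1 + (e + e))
  thin-block₂ = pair-block (thin₂ (last-but-one (proj₂ (nonneg 0≤e))))
    (thin₃ (∈-interval⁺ (p + + 2 + (e + e)) (p + + 2 + (e + e)) (p + + 1 + (e + e) + + 1)
      (≤-reflexive (solve (p ∷ e ∷ []))) (≤-reflexive (solve (p ∷ e ∷ [])))))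

  thick-block₁ : Block (+ 2) (thick p e) (p - + 3)
  thick-block₁ x (lo , hi) = thick₁ (∈-interval⁺ (p - + 3) (p - + 1) x
    lo (≤-trans hi (≤-reflexive (solve (p ∷ [])))))

  thick-block₂ : Block (+ 2) (thick p e) (p + + 3 + (e + e))
  thick-block₂ x (lo , hi) = thick₃ (∈-interval⁺ (p + + 3 + (e + e)) (p + + 5 + (e + e)) x
    lo (≤-trans hi (≤-reflexive (solve (p ∷ e ∷ [])))))

  -- The points p - 3, p - 1, then p + 2, p + 4, ..., p + 2e, then p + 3 + 2e, p + 5 + 2e are at
  -- most 3 apart. Gaps of 3 occur where the alternating part meets the triples.
  thick-window : Window (+ 2) (p - + 3) (p + + 7 + (e + e)) (_∈ thick p e)
  thick-window =
    window-glue (p - + 1)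
      (window-point (p - + 3)
        (thick₁ (∈-interval⁺ (p - + 3) (p - + 1) (p - + 3) ≤-refl (lin 2 0≤0 (solve (p ∷ []))))) ≤-refl)
      (window-glue (p + + 2)
        (window-point (p - + 1)
          (thick₁ (∈-interval⁺ (p - + 3) (p - + 1) (p - + 1) (lin 2 0≤0 (solve (p ∷ []))) ≤-refl)) ≤-refl)
        (window-glue (p + + 3 + (e + e))
          -- The alternating part alone has width 1 up to p + 2e + 1; width 2 takes it to p + 2e +
          -- 2, just before the right triple.
          (window-map thick₂ (window-grow
            (interval2-window (p + + 2) (p + (e + e)) (e - + 1) (solve (p ∷ e ∷ [])))
            (lin 1 (1≤e ⊕ 1≤e) (solve (p ∷ e ∷ [])))))
          (window-glue (p + + 5 + (e + e))
            (window-point (p + + 3 + (e + e))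
              (thick₃ (∈-interval⁺ (p + + 3 + (e + e)) (p + + 5 + (e + e)) (p + + 3 + (e + e))
                ≤-refl (lin 2 0≤0 (solve (p ∷ e ∷ []))))) ≤-refl)
            (window-point (p + + 5 + (e + e))
              (thick₃ (∈-interval⁺ (p + + 3 + (e + e)) (p + + 5 + (e + e)) (p + + 5 + (e + e))
                (lin 2 0≤0 (solve (p ∷ e ∷ []))) ≤-refl))
              (≤-reflexive (solve (p ∷ e ∷ []))))
            (lin 1 0≤0 (solve (p ∷ e ∷ []))))
          (lin 0 0≤0 (solve (p ∷ e ∷ []))))
        (lin 0 0≤0 (solve (p ∷ []))))
      (lin 1 0≤0 (solve (p ∷ [])))

-- Sums in the middle range

module _ (n e S : ℤ) (0≤n : + 0 ≤ n) (1≤e : + 1 ≤ e) (n≤2e : n ≤ e + e) where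

  -- Pairs start at most 2e + 4 apart, which fits the window of length 2e + 3 of a thin set. The
  -- left thin set plus pairs gives the sums from n + 5 to 3n + S + 2e + 6, the right one those from
  -- there to 3n + 2S - 3. The three sums missing at each end come from n plus elements of [1, 4],
  -- and from n + S + 1 plus elements near the maximum.
  pair-chain⇒sums : ∀ {A} x y →
    (∀ z → InI z (+ 1) (+ 4) → z ∈ A) → n ∈ A →
    thin (n + + 4) e ⊆ A →
    Window (e + e + + 3) x (y + (e + e + + 3)) (Block (+ 1) A) →
    x ≤ n + (e + e) + (e + e) + + 8 → n + S - (e + e) - (e + e) - + 8 ≤ y →
    thin (n + S - (e + e) - + 5) e ⊆ A →
    n + S + + 1 ∈ A → (∀ z → InI z (n + n + S - + 3) (n + n + S) → z ∈ A) →
    ∀ s → InI s (n + + 2) (n + n + n + S + S) → s ∈ sumset A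
  pair-chain⇒sums {A} x y first n∈A left middle x≤ ≤y right n+S+1∈A final s (lo , hi) =
    case-≤ s (n + + 4)
      (λ s≤ → ∈-sumset⁺ n (s - n) s n∈A (first (s - n)
        ( lin 1 lo (solve (s ∷ n ∷ [])) , lin 0 s≤ (solve (s ∷ n ∷ [])))) (solve (s ∷ n ∷ [])))
      (λ <s → case-≤ s (n + n + S - + 1 + (e + e + + 3) + (n + + 4))
        (λ s≤ → window+blocks⊆sumset (window-map left (thin-window (n + + 4) e 1≤e))
          blocks (≤-reflexive (solve (n ∷ e ∷ []))) s (lin 0 <s (solve (s ∷ n ∷ [])) , s≤))
        (λ <s → case-≤ s (n + n + n + S + S - + 3)
          (λ s≤ → window+blocks⊆sumset (window-map right (thin-window (n + S - (e + e) - + 5) e 1≤e))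
            blocks (≤-reflexive (solve (n ∷ e ∷ S ∷ []))) s
            -- The two ranges of sums overlap: s exceeds the lower end of the right range by at
            -- least 2n + 4e + 11 = 11 + 2(2e - n) + 4n.
            ( lin 11 (<s ⊕ n≤2e ⊕ n≤2e ⊕ 0≤n ⊕ 0≤n ⊕ 0≤n ⊕ 0≤n) (solve (s ∷ n ∷ e ∷ S ∷ []))
            , lin 0 s≤ (solve (s ∷ n ∷ e ∷ S ∷ []))))
          (λ <s → ∈-sumset⁺ (n + S + + 1) (s - (n + S + + 1)) s n+S+1∈A (final (s - (n + S + + 1))
            ( lin 0 <s (solve (s ∷ n ∷ S ∷ [])) , lin 1 hi (solve (s ∷ n ∷ S ∷ []))))
            (solve (s ∷ n ∷ S ∷ [])))))
    where
    blocks : Window (e + e + + 3) (+ 1) (n + n + S - + 1 + (e + e + + 3)) (Block (+ 1) A)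
    -- The pairs start at 1, n + 4, n + 5 + 2e, then along the chain from x to y, then at n + S - 2e
    -- - 5, n + S - 4 and 2n + S - 1. The first and the last of these steps have length n + 3, which
    -- n ≤ 2e keeps within 2e + 4.
    blocks =
      window-glue (n + + 4)
        (window-point {b = + 1 + (e + e + + 3)} (+ 1)
          (λ z z∈ → first z (proj₁ z∈ , ≤-trans (proj₂ z∈) (+≤+ (s≤s (s≤s z≤n))))) ≤-refl)
        (window-glue (n + + 4 + + 1 + (e + e))
          (window-point {b = n + + 4 + (e + e + + 3)} (n + + 4)
            (λ z → left ∘ thin-block₁ (n + + 4) e 1≤e z) ≤-refl)
          (window-glue x
            (window-point {b = n + + 4 + + 1 + (e + e) + (e + e + + 3)} (n + + 4 + + 1 + (e + e))
              (λ z → left ∘ thin-block₂ (n + + 4) e 1≤e z) ≤-refl)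
            (window-glue (n + S - (e + e) - + 5)
              middle
              (window-glue (n + S - (e + e) - + 5 + + 1 + (e + e))
                (window-point {b = n + S - (e + e) - + 5 + (e + e + + 3)} (n + S - (e + e) - + 5)
                  (λ z → right ∘ thin-block₁ (n + S - (e + e) - + 5) e 1≤e z) ≤-refl)
                (window-glue (n + n + S - + 1)
                  (window-point {b = n + S - (e + e) - + 5 + + 1 + (e + e) + (e + e + + 3)}
                    (n + S - (e + e) - + 5 + + 1 + (e + e))
                    (λ z → right ∘ thin-block₂ (n + S - (e + e) - + 5) e 1≤e z) ≤-refl)
                  (window-point (n + n + S - + 1)
                    (λ z z∈ → final z
                      ( ≤-trans (lin {b = n + n + S - + 1} 2 0≤0 (solve (n ∷ S ∷ []))) (proj₁ z∈)
                      , ≤-trans (proj₂ z∈) (≤-reflexive (solve (n ∷ S ∷ []))))) ≤-refl)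
                  (lin 1 n≤2e (solve (n ∷ e ∷ S ∷ []))))
                (lin 3 0≤0 (solve (n ∷ e ∷ S ∷ []))))
              (lin 1 ≤y (solve (n ∷ e ∷ S ∷ y ∷ []))))
            (lin 1 x≤ (solve (n ∷ e ∷ x ∷ []))))
          (lin 3 0≤0 (solve (n ∷ e ∷ []))))
        (lin 1 n≤2e (solve (n ∷ e ∷ [])))

  -- Triples start at most 2e + 11 apart, and the window of a thick set has length 2e + 10. The two
  -- thick sets give the whole range: its lower end is 5 + (n + 1), and its upper end is reached
  -- from the last triple, which starts at 2n + S - 6.
  triple-chain⇒sums : ∀ {A} x y →
    (∀ z → InI z (+ 5) (+ 7) → z ∈ A) →
    thick (n + + 4) e ⊆ A →
    Window (e + e + + 10) x (y + (e + e + + 10)) (Block (+ 2) A) →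
    x ≤ n + (e + e) + (e + e) + + 11 → n + S - (e + e) - (e + e) - + 12 ≤ y →
    thick (n + S - (e + e) - + 5) e ⊆ A →
    (∀ z → InI z (n + n + S - + 6) (n + n + S - + 4) → z ∈ A) →
    ∀ s → InI s (n + + 6) (n + n + n + S + S - + 4) → s ∈ sumset A
  triple-chain⇒sums {A} x y first left middle x≤ ≤y right final s (lo , hi) =
    case-≤ s (n + n + S - + 6 + (e + e + + 10) + (n + + 4 - + 3))
      (λ s≤ → window+blocks⊆sumset (window-map left (thick-window (n + + 4) e 1≤e))
        blocks (≤-reflexive (solve (n ∷ e ∷ []))) s (lin 0 lo (solve (s ∷ n ∷ [])) , s≤))
      (λ <s → window+blocks⊆sumset (window-map right (thick-window (n + S - (e + e) - + 5) e 1≤e))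
        blocks (≤-reflexive (solve (n ∷ e ∷ S ∷ []))) s
        ( lin 9 (<s ⊕ n≤2e ⊕ n≤2e ⊕ 0≤n ⊕ 0≤n ⊕ 0≤n ⊕ 0≤n) (solve (s ∷ n ∷ e ∷ S ∷ []))
        , lin 0 hi (solve (s ∷ n ∷ e ∷ S ∷ []))))
    where
    blocks : Window (e + e + + 10) (+ 5) (n + n + S - + 6 + (e + e + + 10)) (Block (+ 2) A)
    blocks =
      window-glue (n + + 4 - + 3)
        (window-point {b = + 5 + (e + e + + 10)} (+ 5) first ≤-refl)
        (window-glue (n + + 4 + + 3 + (e + e))
          (window-point {b = n + + 4 - + 3 + (e + e + + 10)} (n + + 4 - + 3)
            (λ z → left ∘ thick-block₁ (n + + 4) e 1≤e z) ≤-refl)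
          (window-glue x
            (window-point {b = n + + 4 + + 3 + (e + e) + (e + e + + 10)} (n + + 4 + + 3 + (e + e))
              (λ z → left ∘ thick-block₂ (n + + 4) e 1≤e z) ≤-refl)
            (window-glue (n + S - (e + e) - + 5 - + 3)
              middle
              (window-glue (n + S - (e + e) - + 5 + + 3 + (e + e))
                (window-point {b = n + S - (e + e) - + 5 - + 3 + (e + e + + 10)} (n + S - (e + e) - + 5 - + 3)
                  (λ z → right ∘ thick-block₁ (n + S - (e + e) - + 5) e 1≤e z) ≤-refl)
                (window-glue (n + n + S - + 6)
                  (window-point {b = n + S - (e + e) - + 5 + + 3 + (e + e) + (e + e + + 10)}
                    (n + S - (e + e) - + 5 + + 3 + (e + e))
                    (λ z → right ∘ thick-block₂ (n + S - (e + e) - + 5) e 1≤e z) ≤-refl)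
                  (window-point (n + n + S - + 6)
                    (λ z z∈ → final z
                      (proj₁ z∈ , ≤-trans (proj₂ z∈) (≤-reflexive (solve (n ∷ S ∷ []))))) ≤-refl)
                  (lin 15 n≤2e (solve (n ∷ e ∷ S ∷ []))))
                (lin 5 0≤0 (solve (n ∷ e ∷ S ∷ []))))
              (lin 7 ≤y (solve (n ∷ e ∷ S ∷ y ∷ []))))
            (lin 7 x≤ (solve (n ∷ e ∷ x ∷ []))))
          (lin 5 0≤0 (solve (n ∷ e ∷ []))))
        (lin 15 n≤2e (solve (n ∷ e ∷ [])))

-- Extending the sets in the middle

∈-shift⁺ : ∀ {X} t y → y - t ∈ X → y ∈ shift X t
∈-shift⁺ {X} t y y-t∈X = subst (_∈ shift X t) y-t+t≡y (∈-map⁺ (λ x → x + t) y-t∈X)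
  where
  y-t+t≡y : y - t + t ≡ y
  y-t+t≡y = solve (y ∷ t ∷ [])

partition-shift : ∀ {X Y a b} t → Partition X Y a b → Partition (shift X t) (shift Y t) (a + t) (b + t)
partition-shift {X} {Y} {a} {b} t p = record
  { left = λ y∈ → bounds (left p) (∈-map⁻ (λ x → x + t) y∈)
  ; right = λ y∈ → bounds (right p) (∈-map⁻ (λ x → x + t) y∈)
  ; disjoint = λ y∈ y∈′ → separate (∈-map⁻ (λ x → x + t) y∈) (∈-map⁻ (λ x → x + t) y∈′)
  ; cover = λ y (lo , hi) → Sum.map (∈-shift⁺ t y) (∈-shift⁺ t y) (cover p (y - t)
      ( lin 0 lo (solve (y ∷ a ∷ t ∷ [])) , lin 0 hi (solve (y ∷ b ∷ t ∷ []))))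
  }
  where
  bounds : ∀ {Z y} → (∀ {x} → x ∈ Z → InI x a b) → ∃[ x ] (x ∈ Z × y ≡ x + t) → InI y (a + t) (b + t)
  bounds Z⊆ (x , x∈Z , refl) = Z⊆ x∈Z .proj₁ ⊕ ≤-refl , Z⊆ x∈Z .proj₂ ⊕ ≤-refl
  cancel : ∀ x y → x + t ≡ y + t → y ≡ x
  cancel x y e = lin-≡ (sym e) (solve (x ∷ y ∷ t ∷ []))
  separate : ∀ {y} → ∃[ x ] (x ∈ X × y ≡ x + t) → ∃[ x ] (x ∈ Y × y ≡ x + t) → ⊥
  separate (x , x∈X , refl) (x′ , x′∈Y , e) =
    disjoint p x∈X (subst (_∈ Y) (cancel x x′ e) x′∈Y)

-- The four elements at each end belong to X. This is the origin of c = 4 for the second colour.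
inner-bounds : ∀ {X Y a b} → Partition X Y a b →
  (∀ z → InI z a (a + + 3) → z ∈ X) → (∀ z → InI z (b - + 3) b → z ∈ X) →
  ∀ {x} → x ∈ Y → InI x (a + + 4) (b - + 4)
inner-bounds {X} {Y} {a} {b} p first final {x} x∈Y =
  case-≤ {C = a + + 4 ≤ x} x (a + + 3)
    (λ x≤ → ⊥-elim (disjoint p (first x (proj₁ (right p x∈Y) , x≤)) x∈Y))
    (λ <x → lin 0 <x (solve (x ∷ a ∷ []))) ,
  case-≤ {C = x ≤ b - + 4} x (b - + 4)
    (λ x≤ → x≤)
    (λ <x → ⊥-elim (disjoint p (final x
      (lin 0 <x (solve (x ∷ b ∷ [])) , proj₂ (right p x∈Y))) x∈Y))

-- An element of the concatenation lies in L, in the inserted range [n + 1, n + S] or in R + S.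
-- Hence the part up to n is L again, and the part above n + S is the shifted R.
insertion-MSTD : (n c S : ℤ) → + 0 ≤ S → c + + 1 ≤ n → (A L R O M O′ : ZSet) →
  (∀ x → x ∈ A ⇔ (x ∈ L ⊎ x ∈ R)) →
  (∀ {x} → x ∈ L → x ≤ n) → (∀ {x} → x ∈ R → n + + 1 ≤ x) →
  (∀ {x} → x ∈ O → InI x (n + + 1) (n + S)) → (∀ {x} → x ∈ M → InI x (n + + 1) (n + S)) →
  (∀ {x} → x ∈ O′ → InI x (n + + 1) (n + S)) →
  (∀ {x} → x ∈ A → InI x (c + + 1) (n + n - c)) →
  (∀ x → InI x (c + + 1 - n) (n - c - + 1) → x ∈ diffset A) →
  (∀ {x} → x ∈ L ++ O ++ M ++ O′ ++ shift R S → InI x (c + + 1) (n + n + S - c)) →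
  (∀ x → InI x (n + c + + 2) (n + n + n + S + S - c) → x ∈ sumset (L ++ O ++ M ++ O′ ++ shift R S)) →
  MSTD A → MSTD (L ++ O ++ M ++ O′ ++ shift R S)
insertion-MSTD n c S 0≤S c<n A L R O M O′ A⇔ L≤n n<R O-mid M-mid O′-mid A-bounds A-diffs A′-bounds A′-sums =
  MSTD-insert-middle n c S 0≤S c<n A L R A′
    (λ {x} → from (A⇔ x) ∘ inj₁) (λ {x} → from (A⇔ x) ∘ inj₂) (λ {x} → to (A⇔ x))
    A-bounds L≤n n<R A-diffs A′-bounds ∈-++⁺ˡ
    (λ x∈R → ∈-++⁺ʳ L (∈-++⁺ʳ O (∈-++⁺ʳ M (∈-++⁺ʳ O′ (∈-map⁺ (λ x → x + S) x∈R)))))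
    small large A′-sums
  where
  A′ = L ++ O ++ M ++ O′ ++ shift R S

  data Part (x : ℤ) : Set where
    in-L : x ∈ L → Part x
    in-middle : InI x (n + + 1) (n + S) → Part x
    in-R : ∀ y → y ∈ R → x ≡ y + S → Part x

  part : ∀ {x} → x ∈ A′ → Part x
  part x∈ with ∈-++⁻ L x∈
  ... | inj₁ x∈L = in-L x∈L
  ... | inj₂ x∈ with ∈-++⁻ O x∈
  ... | inj₁ x∈O = in-middle (O-mid x∈O)
  ... | inj₂ x∈ with ∈-++⁻ M x∈
  ... | inj₁ x∈M = in-middle (M-mid x∈M)
  ... | inj₂ x∈ with ∈-++⁻ O′ x∈
  ... | inj₁ x∈O′ = in-middle (O′-mid x∈O′)
  ... | inj₂ x∈ with ∈-map⁻ (λ x → x + S) x∈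
  ... | y , y∈R , x≡y+S = in-R y y∈R x≡y+S

  small : ∀ {x} → x ∈ A′ → x ≤ n → x ∈ L
  small {x} x∈ x≤n with part x∈
  ... | in-L x∈L = x∈L
  ... | in-middle (n<x , _) = ⊥-elim (lin-⊥ 0 (n<x ⊕ x≤n) (solve (n ∷ x ∷ [])))
  ... | in-R y y∈R refl = ⊥-elim (lin-⊥ 0 (n<R y∈R ⊕ x≤n ⊕ 0≤S) (solve (n ∷ y ∷ S ∷ [])))

  large : ∀ {x} → x ∈ A′ → n + S + + 1 ≤ x → x - S ∈ R
  large {x} x∈ n+S<x with part x∈
  ... | in-L x∈L = ⊥-elim (lin-⊥ 0 (n+S<x ⊕ L≤n x∈L ⊕ 0≤S) (solve (n ∷ x ∷ S ∷ [])))
  ... | in-middle (_ , x≤n+S) = ⊥-elim (lin-⊥ 0 (n+S<x ⊕ x≤n+S) (solve (n ∷ x ∷ S ∷ [])))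
  ... | in-R y y∈R refl = subst (_∈ R) (y≡y+S-S y) y∈R
    where
    y≡y+S-S : ∀ y → y ≡ y + S - S
    y≡y+S-S y = solve (y ∷ S ∷ [])

-- The statement in the variables e = k - 2 and S = m + 4 * k + 4.
module Expansion
  (n e S : ℤ) (n≤2e : n ≤ e + e) (4e+18≤S : e + e + (e + e) + + 18 ≤ S)
  (A₁ A₂ L₁ R₁ L₂ R₂ M₁ M₂ : ZSet)
  (P₁ : IsP n A₁) (P₂ : IsP (n - + 4) A₂)
  (A₁⇔ : ∀ x → x ∈ A₁ ⇔ (x ∈ L₁ ⊎ x ∈ R₁)) (A₂⇔ : ∀ x → x ∈ A₂ ⇔ (x ∈ L₂ ⊎ x ∈ R₂))
  (L-part : Partition L₁ L₂ (+ 1) n) (R-part : Partition R₁ R₂ (n + + 1) (n + n))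
  (M-part : Partition M₁ M₂ (n + (e + e) + + 10) (n + S - (e + e) - + 9))
  (L₁-first : ∀ x → InI x (+ 1) (+ 4) → x ∈ L₁) (n∈L₁ : n ∈ L₁)
  (n+1∈R₁ : n + + 1 ∈ R₁) (R₁-last : ∀ x → InI x (n + n - + 3) (n + n) → x ∈ R₁)
  (L₂-first : ∀ x → InI x (+ 5) (+ 7) → x ∈ L₂)
  (R₂-last : ∀ x → InI x (n + n - + 6) (n + n - + 4) → x ∈ R₂)
  where

  private
    q : ℤ
    q = n + S - (e + e) - + 5

  A₁′ A₂′ : ZSet
  A₁′ = L₁ ++ thin (n + + 4) e ++ M₁ ++ thin (n + S - (e + e) - + 5) e ++ shift R₁ S
  A₂′ = L₂ ++ thick (n + + 4) e ++ M₂ ++ thick (n + S - (e + e) - + 5) e ++ shift R₂ S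

  -- As 7 lies in L₂, it lies in [1, n]; together with n ≤ 2e this will make e positive.
  7≤n : + 7 ≤ n
  7≤n = proj₂ (right L-part (L₂-first (+ 7) (from-yes (+ 5 ≤? + 7) , ≤-refl)))

  0≤n : + 0 ≤ n
  0≤n = ≤-trans (+≤+ z≤n) 7≤n

  1≤e : + 1 ≤ e
  1≤e = case-≤ {C = + 1 ≤ e} e (+ 0)
    (λ e≤0 → ⊥-elim (lin-⊥ 6 (7≤n ⊕ n≤2e ⊕ e≤0 ⊕ e≤0) (solve (n ∷ e ∷ []))))
    (λ 0<e → 0<e)

  0≤S : + 0 ≤ S
  0≤S = lin 22 (4e+18≤S ⊕ 1≤e ⊕ 1≤e ⊕ 1≤e ⊕ 1≤e) (solve (e ∷ S ∷ []))

  O-part : Partition (thin (n + + 4) e) (thick (n + + 4) e) (n + + 4 - + 3) (n + + 4 + + 5 + (e + e))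
  O-part = thin-thick-partition (n + + 4) e 1≤e

  O′-part : Partition (thin q e) (thick q e) (q - + 3) (q + + 5 + (e + e))
  O′-part = thin-thick-partition q e 1≤e

  A-part : Partition (L₁ ++ R₁) (L₂ ++ R₂) (+ 1) (n + n)
  A-part = glue (+ 1) n (n + + 1) (n + n) refl
    (lin 0 0≤n (solve (n ∷ []))) (lin 0 0≤n (solve (n ∷ []))) L-part R-part

  A′-part : Partition A₁′ A₂′ (+ 1) (n + n + S)
  A′-part =
    glue (+ 1) n (n + + 4 - + 3) (n + n + S) (solve (n ∷ []))
      (lin 0 0≤n (solve (n ∷ []))) (lin 0 (0≤n ⊕ 0≤S) (solve (n ∷ S ∷ []))) L-part
    (glue (n + + 4 - + 3) (n + + 4 + + 5 + (e + e)) (n + (e + e) + + 10) (n + n + S) (solve (n ∷ e ∷ []))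
      (lin 11 (1≤e ⊕ 1≤e) (solve (n ∷ e ∷ []))) (lin 11 (0≤n ⊕ 4e+18≤S ⊕ 1≤e ⊕ 1≤e) (solve (n ∷ e ∷ S ∷ [])))
      O-part
    (glue (n + (e + e) + + 10) (n + S - (e + e) - + 9) (n + S - (e + e) - + 5 - + 3) (n + n + S)
      (solve (n ∷ e ∷ S ∷ []))
      -- The middle interval has S - 4e - 18 elements, which must not be negative.
      (lin 0 4e+18≤S (solve (n ∷ e ∷ S ∷ []))) (lin 11 (0≤n ⊕ 1≤e ⊕ 1≤e) (solve (n ∷ e ∷ S ∷ [])))
      M-part
    (glue (n + S - (e + e) - + 5 - + 3) (n + S - (e + e) - + 5 + + 5 + (e + e)) (n + + 1 + S) (n + n + S)
      (solve (n ∷ e ∷ S ∷ []))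
      (lin 11 (1≤e ⊕ 1≤e) (solve (n ∷ e ∷ S ∷ []))) (lin 0 0≤n (solve (n ∷ e ∷ S ∷ [])))
      O′-part (partition-shift S R-part))))

  O-mid : ∀ {x} → InI x (n + + 4 - + 3) (n + + 4 + + 5 + (e + e)) → InI x (n + + 1) (n + S)
  O-mid {x} (lo , hi) = lin 0 lo (solve (x ∷ n ∷ [])) ,
    lin 11 (hi ⊕ 4e+18≤S ⊕ 1≤e ⊕ 1≤e) (solve (x ∷ n ∷ e ∷ S ∷ []))

  M-mid : ∀ {x} → InI x (n + (e + e) + + 10) (n + S - (e + e) - + 9) → InI x (n + + 1) (n + S)
  M-mid {x} (lo , hi) = lin 11 (lo ⊕ 1≤e ⊕ 1≤e) (solve (x ∷ n ∷ e ∷ [])) ,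
    lin 11 (hi ⊕ 1≤e ⊕ 1≤e) (solve (x ∷ n ∷ e ∷ S ∷ []))

  O′-mid : ∀ {x} → InI x (n + S - (e + e) - + 5 - + 3) (n + S - (e + e) - + 5 + + 5 + (e + e)) →
    InI x (n + + 1) (n + S)
  O′-mid {x} (lo , hi) =
    lin 11 (lo ⊕ 4e+18≤S ⊕ 1≤e ⊕ 1≤e) (solve (x ∷ n ∷ e ∷ S ∷ [])) ,
    lin 0 hi (solve (x ∷ n ∷ e ∷ S ∷ []))

  L₁⊆A₁′ : L₁ ⊆ A₁′
  L₁⊆A₁′ = ∈-++⁺ˡ

  O₁₁⊆A₁′ : thin (n + + 4) e ⊆ A₁′
  O₁₁⊆A₁′ = ∈-++⁺ʳ L₁ ∘ ∈-++⁺ˡ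

  M₁⊆A₁′ : M₁ ⊆ A₁′
  M₁⊆A₁′ = ∈-++⁺ʳ L₁ ∘ ∈-++⁺ʳ (thin (n + + 4) e) ∘ ∈-++⁺ˡ

  O₁₂⊆A₁′ : thin q e ⊆ A₁′
  O₁₂⊆A₁′ = ∈-++⁺ʳ L₁ ∘ ∈-++⁺ʳ (thin (n + + 4) e) ∘ ∈-++⁺ʳ M₁ ∘ ∈-++⁺ˡ

  R₁+S⊆A₁′ : ∀ {x} → x - S ∈ R₁ → x ∈ A₁′
  R₁+S⊆A₁′ {x} = ∈-++⁺ʳ L₁ ∘ ∈-++⁺ʳ (thin (n + + 4) e) ∘ ∈-++⁺ʳ M₁ ∘ ∈-++⁺ʳ (thin q e) ∘ ∈-shift⁺ S x

  A₁′-last : ∀ x → InI x (n + n + S - + 3) (n + n + S) → x ∈ A₁′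
  A₁′-last x (lo , hi) = R₁+S⊆A₁′ (R₁-last (x - S)
    (lin 0 lo (solve (x ∷ n ∷ S ∷ [])) , lin 0 hi (solve (x ∷ n ∷ S ∷ []))))

  -- Here c = 0: the extremes of A₁ are 1 and 2n, so P with parameter n yields all differences from
  -- 1 - n to n - 1.
  A₁′-MSTD : ∀ x y → Window (e + e + + 3) x (y + (e + e + + 3)) (Block (+ 1) M₁) →
    x ≤ n + (e + e) + (e + e) + + 8 → n + S - (e + e) - (e + e) - + 8 ≤ y →
    MSTD A₁ → MSTD A₁′
  A₁′-MSTD x y pairs x≤ ≤y = insertion-MSTD n (+ 0) S 0≤S (≤-trans (+≤+ (s≤s z≤n)) 7≤n)
    A₁ L₁ R₁ (thin (n + + 4) e) M₁ (thin q e) A₁⇔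
    (proj₂ ∘ left L-part) (proj₁ ∘ left R-part)
    (O-mid ∘ left O-part) (M-mid ∘ left M-part) (O′-mid ∘ left O′-part)
    (λ {x} x∈ → let lo , hi = bounds x x∈ in lo , lin 0 hi (solve (x ∷ n ∷ [])))
    (λ x (lo , hi) → proj₂
      (P₁ (+ 1) (n + n)
        (from (A₁⇔ (+ 1)) (inj₁ (L₁-first (+ 1) (≤-refl , from-yes (+ 1 ≤? + 4)))))
        (from (A₁⇔ (n + n)) (inj₂ (R₁-last (n + n) (lin 3 0≤0 (solve (n ∷ [])) , ≤-refl))))
        bounds)
      x (lin 0 lo (solve (x ∷ n ∷ [])) , lin 0 hi (solve (x ∷ n ∷ []))))
    (λ {x} x∈ → let lo , hi = left A′-part x∈ in lo , lin 0 hi (solve (x ∷ n ∷ S ∷ [])))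
    (λ s (lo , hi) → pair-chain⇒sums n e S 0≤n 1≤e n≤2e x y
      (λ z → L₁⊆A₁′ ∘ L₁-first z) (L₁⊆A₁′ n∈L₁) O₁₁⊆A₁′
      (window-map (λ block z → M₁⊆A₁′ ∘ block z) pairs) x≤ ≤y O₁₂⊆A₁′
      (R₁+S⊆A₁′ (subst (_∈ R₁) (cancel S) n+1∈R₁)) A₁′-last
      s (lin 0 lo (solve (s ∷ n ∷ [])) , lin 0 hi (solve (s ∷ n ∷ S ∷ []))))
    where
    bounds : ∀ x → x ∈ A₁ → InI x (+ 1) (n + n)
    bounds x x∈ = left A-part ([ ∈-++⁺ˡ , ∈-++⁺ʳ L₁ ]′ (to (A₁⇔ x) x∈))
    cancel : ∀ S → n + + 1 ≡ n + S + + 1 - S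
    cancel S = solve (n ∷ S ∷ [])

  L₂⊆A₂′ : L₂ ⊆ A₂′
  L₂⊆A₂′ = ∈-++⁺ˡ

  O₂₁⊆A₂′ : thick (n + + 4) e ⊆ A₂′
  O₂₁⊆A₂′ = ∈-++⁺ʳ L₂ ∘ ∈-++⁺ˡ

  M₂⊆A₂′ : M₂ ⊆ A₂′
  M₂⊆A₂′ = ∈-++⁺ʳ L₂ ∘ ∈-++⁺ʳ (thick (n + + 4) e) ∘ ∈-++⁺ˡ

  O₂₂⊆A₂′ : thick q e ⊆ A₂′
  O₂₂⊆A₂′ = ∈-++⁺ʳ L₂ ∘ ∈-++⁺ʳ (thick (n + + 4) e) ∘ ∈-++⁺ʳ M₂ ∘ ∈-++⁺ˡ

  R₂+S⊆A₂′ : ∀ {x} → x - S ∈ R₂ → x ∈ A₂′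
  R₂+S⊆A₂′ {x} = ∈-++⁺ʳ L₂ ∘ ∈-++⁺ʳ (thick (n + + 4) e) ∘ ∈-++⁺ʳ M₂ ∘ ∈-++⁺ʳ (thick q e) ∘ ∈-shift⁺ S x

  A₂′-last : ∀ x → InI x (n + n + S - + 6) (n + n + S - + 4) → x ∈ A₂′
  A₂′-last x (lo , hi) = R₂+S⊆A₂′ (R₂-last (x - S)
    (lin 0 lo (solve (x ∷ n ∷ S ∷ [])) , lin 0 hi (solve (x ∷ n ∷ S ∷ []))))

  -- Here c = 4: the extremes of A₂ are 5 and 2n - 4, so P with parameter n - 4 yields all
  -- differences from 5 - n to n - 5.
  A₂′-MSTD : ∀ x y → Window (e + e + + 10) x (y + (e + e + + 10)) (Block (+ 2) M₂) →
    x ≤ n + (e + e) + (e + e) + + 11 → n + S - (e + e) - (e + e) - + 12 ≤ y →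
    MSTD A₂ → MSTD A₂′
  A₂′-MSTD x y triples x≤ ≤y = insertion-MSTD n (+ 4) S 0≤S (≤-trans (from-yes (+ 5 ≤? + 7)) 7≤n)
    A₂ L₂ R₂ (thick (n + + 4) e) M₂ (thick q e) A₂⇔
    (proj₂ ∘ right L-part) (proj₁ ∘ right R-part)
    (O-mid ∘ right O-part) (M-mid ∘ right M-part) (O′-mid ∘ right O′-part)
    (λ {x} → bounds x)
    (λ x (lo , hi) → proj₂
      (P₂ (+ 5) (n + n - + 4)
        (from (A₂⇔ (+ 5)) (inj₁ (L₂-first (+ 5) (≤-refl , from-yes (+ 5 ≤? + 7)))))
        (from (A₂⇔ (n + n - + 4)) (inj₂ (R₂-last (n + n - + 4) (lin 2 0≤0 (solve (n ∷ [])) , ≤-refl))))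
        bounds)
      x (lin 0 lo (solve (x ∷ n ∷ [])) , lin 0 hi (solve (x ∷ n ∷ []))))
    (inner-bounds A′-part (λ z → L₁⊆A₁′ ∘ L₁-first z) A₁′-last)
    (λ s (lo , hi) → triple-chain⇒sums n e S 0≤n 1≤e n≤2e x y
      (λ z → L₂⊆A₂′ ∘ L₂-first z) O₂₁⊆A₂′
      (window-map (λ block z → M₂⊆A₂′ ∘ block z) triples) x≤ ≤y O₂₂⊆A₂′
      A₂′-last s (lin 0 lo (solve (s ∷ n ∷ [])) , hi))
    where
    bounds : ∀ x → x ∈ A₂ → InI x (+ 5) (n + n - + 4)
    bounds x x∈ = inner-bounds A-part (λ z → ∈-++⁺ˡ ∘ L₁-first z) (λ z → ∈-++⁺ʳ L₁ ∘ R₁-last z)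
      ([ ∈-++⁺ˡ , ∈-++⁺ʳ L₂ ]′ (to (A₂⇔ x) x∈))

-- Return to the variables n, k and m

thin-≡ : ∀ p e a b c → p + + 1 ≡ a → p + + 1 + (e + e) ≡ b → p + + 2 + (e + e) ≡ c →
  thin p e ≡ interval p p ++ interval2 a b ++ interval c c
thin-≡ p e _ _ _ refl refl refl = refl

thick-≡ : ∀ p e a b c d f g → p - + 3 ≡ a → p - + 1 ≡ b → p + + 2 ≡ c → p + (e + e) ≡ d →
  p + + 3 + (e + e) ≡ f → p + + 5 + (e + e) ≡ g →
  thick p e ≡ interval a b ++ interval2 c d ++ interval f g
thick-≡ p e _ _ _ _ _ _ refl refl refl refl refl refl = refl

-- A covered point up to n cannot lie in a right half, and one above n cannot lie in a left half; so
-- the partition of [1, 2n] restricts to both halves.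
halves : ∀ {n A₁ A₂ L₁ R₁ L₂ R₂} → + 0 ≤ n →
  (∀ x → x ∈ A₁ → x ∉ A₂) → (∀ x → (x ∈ A₁ ⊎ x ∈ A₂) ⇔ InI x (+ 1) (+ 2 * n)) →
  (∀ x → x ∈ A₁ ⇔ (x ∈ L₁ ⊎ x ∈ R₁)) → (∀ x → x ∈ A₂ ⇔ (x ∈ L₂ ⊎ x ∈ R₂)) →
  (∀ x → x ∈ L₁ → InI x (+ 1) n) → (∀ x → x ∈ R₁ → InI x (n + + 1) (+ 2 * n)) →
  (∀ x → x ∈ L₂ → InI x (+ 1) n) → (∀ x → x ∈ R₂ → InI x (n + + 1) (+ 2 * n)) →
  Partition L₁ L₂ (+ 1) n × Partition R₁ R₂ (n + + 1) (n + n)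
halves {n} {A₁} {A₂} {L₁} {R₁} {L₂} {R₂} 0≤n apart A-cover A₁⇔ A₂⇔ L₁-bounds R₁-bounds L₂-bounds R₂-bounds =
  record
    { left = λ {x} → L₁-bounds x
    ; right = λ {x} → L₂-bounds x
    ; disjoint = λ {x} x∈L₁ x∈L₂ → apart x (from (A₁⇔ x) (inj₁ x∈L₁)) (from (A₂⇔ x) (inj₁ x∈L₂))
    ; cover = λ x (lo , hi) → Sum.map (small R₁-bounds x hi ∘ to (A₁⇔ x)) (small R₂-bounds x hi ∘ to (A₂⇔ x))
        (from (A-cover x) (lo , lin 0 (hi ⊕ 0≤n) (solve (x ∷ n ∷ []))))
    } ,
  record
    { left = λ {x} → upper x ∘ R₁-bounds x
    ; right = λ {x} → upper x ∘ R₂-bounds x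
    ; disjoint = λ {x} x∈R₁ x∈R₂ → apart x (from (A₁⇔ x) (inj₂ x∈R₁)) (from (A₂⇔ x) (inj₂ x∈R₂))
    ; cover = λ x (lo , hi) → Sum.map (large L₁-bounds x lo ∘ to (A₁⇔ x)) (large L₂-bounds x lo ∘ to (A₂⇔ x))
        (from (A-cover x) (lin 0 (lo ⊕ 0≤n) (solve (x ∷ n ∷ [])) , lin 0 hi (solve (x ∷ n ∷ []))))
    }
  where
  upper : ∀ x → InI x (n + + 1) (+ 2 * n) → InI x (n + + 1) (n + n)
  upper x (lo , hi) = lo , lin 0 hi (solve (x ∷ n ∷ []))
  small : ∀ {L R : ZSet} → (∀ x → x ∈ R → InI x (n + + 1) (+ 2 * n)) → ∀ x → x ≤ n → x ∈ L ⊎ x ∈ R → x ∈ L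
  small _ x x≤n (inj₁ x∈L) = x∈L
  small R-bounds x x≤n (inj₂ x∈R) =
    ⊥-elim (lin-⊥ 0 (proj₁ (R-bounds x x∈R) ⊕ x≤n) (solve (x ∷ n ∷ [])))
  large : ∀ {L R : ZSet} → (∀ x → x ∈ L → InI x (+ 1) n) → ∀ x → n + + 1 ≤ x → x ∈ L ⊎ x ∈ R → x ∈ R
  large _ x n<x (inj₂ x∈R) = x∈R
  large L-bounds x n<x (inj₁ x∈L) =
    ⊥-elim (lin-⊥ 0 (proj₂ (L-bounds x x∈L) ⊕ n<x) (solve (x ∷ n ∷ [])))

theorem1p1 :
  (n : ℤ) → + 0 < n →
  (A₁ A₂ L₁ R₁ L₂ R₂ : ZSet) →
  MSTD A₁ → MSTD A₂ → IsP n A₁ → IsP (n - + 4) A₂ →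
  -- (1)
  (∀ x → x ∈ A₁ → x ∉ A₂) →
  (∀ x → (x ∈ A₁ ⊎ x ∈ A₂) ⇔ InI x (+ 1) (+ 2 * n)) →
  -- (2)
  (∀ x → x ∈ A₁ ⇔ (x ∈ L₁ ⊎ x ∈ R₁)) →
  (∀ x → x ∈ A₂ ⇔ (x ∈ L₂ ⊎ x ∈ R₂)) →
  (∀ x → x ∈ L₁ → InI x (+ 1) n) → (∀ x → x ∈ R₁ → InI x (n + + 1) (+ 2 * n)) →
  (∀ x → x ∈ L₂ → InI x (+ 1) n) → (∀ x → x ∈ R₂ → InI x (n + + 1) (+ 2 * n)) →
  -- (3)
  (∀ x → InI x (+ 1) (+ 4) → x ∈ L₁) → n ∈ L₁ →
  n + + 1 ∈ R₁ → (∀ x → InI x (+ 2 * n - + 3) (+ 2 * n) → x ∈ R₁) →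
  -- (4)
  (∀ x → InI x (+ 5) (+ 7) → x ∈ L₂) →
  (∀ x → InI x (+ 2 * n - + 6) (+ 2 * n - + 4) → x ∈ R₂) →
  -- k ≥ n/2 + 2, m ≥ 0
  (k m : ℤ) → n + + 4 ≤ + 2 * k → + 0 ≤ m →
  (M₁ M₂ : ZSet) →
  (∀ x → x ∈ M₁ → InI x (n + + 2 * k + + 6) (n + m + + 2 * k - + 1)) →
  (∀ x → x ∈ M₂ → InI x (n + + 2 * k + + 6) (n + m + + 2 * k - + 1)) →
  -- chain of pairs {x_j, x_j+1} ⊆ M₁, j = 0..t
  (Σ ℕ λ t → Σ (ℕ → ℤ) λ xs →
    ((∀ j → j ℕ.≤ t → (xs j ∈ M₁ × xs j + + 1 ∈ M₁)) ×
     (∀ j → j ℕ.< t → (xs j < xs (suc j) × xs (suc j) - xs j ≤ + 2 * k - + 1)) ×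
     (InI (xs 0) (n + + 2 * k + + 6) (n + + 4 * k + + 1) ×
      InI (xs 0 + + 1) (n + + 2 * k + + 6) (n + + 4 * k + + 1)) ×
     (InI (xs t) (n + m + + 4) (n + m + + 2 * k - + 1) ×
      InI (xs t + + 1) (n + m + + 4) (n + m + + 2 * k - + 1)))) →
  -- chain of triplets {y_j, y_j+1, y_j+2} ⊆ M₂, j = 0..s
  (Σ ℕ λ s → Σ (ℕ → ℤ) λ ys →
    ((∀ j → j ℕ.≤ s → (ys j ∈ M₂ × ys j + + 1 ∈ M₂ × ys j + + 2 ∈ M₂)) ×
     (∀ j → j ℕ.< s → (ys j < ys (suc j) × ys (suc j) - ys j ≤ + 2 * k + + 5)) ×
     (InI (ys 0) (n + + 2 * k + + 6) (n + + 4 * k + + 5) ×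
      InI (ys 0 + + 2) (n + + 2 * k + + 6) (n + + 4 * k + + 5)) ×
     (InI (ys s) (n + m) (n + m + + 2 * k - + 1) ×
      InI (ys s + + 2) (n + m) (n + m + + 2 * k - + 1)))) →
  (∀ x → x ∈ M₁ → x ∉ M₂) →
  (∀ x → (x ∈ M₁ ⊎ x ∈ M₂) ⇔ InI x (n + + 2 * k + + 6) (n + m + + 2 * k - + 1)) →
  let R₁' = shift R₁ (m + + 4 * k + + 4)
      R₂' = shift R₂ (m + + 4 * k + + 4)
      O₁₁ = interval (n + + 4) (n + + 4) ++ interval2 (n + + 5) (n + + 2 * k + + 1)
              ++ interval (n + + 2 * k + + 2) (n + + 2 * k + + 2)
      O₁₂ = interval (n + m + + 2 * k + + 3) (n + m + + 2 * k + + 3)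
              ++ interval2 (n + m + + 2 * k + + 4) (n + m + + 4 * k)
              ++ interval (n + m + + 4 * k + + 1) (n + m + + 4 * k + + 1)
      O₂₁ = interval (n + + 1) (n + + 3) ++ interval2 (n + + 6) (n + + 2 * k)
              ++ interval (n + + 2 * k + + 3) (n + + 2 * k + + 5)
      O₂₂ = interval (n + m + + 2 * k) (n + m + + 2 * k + + 2)
              ++ interval2 (n + m + + 2 * k + + 5) (n + m + + 4 * k - + 1)
              ++ interval (n + m + + 4 * k + + 2) (n + m + + 4 * k + + 4)
      A₁' = L₁ ++ O₁₁ ++ M₁ ++ O₁₂ ++ R₁'
      A₂' = L₂ ++ O₂₁ ++ M₂ ++ O₂₂ ++ R₂'
  in MSTD A₁' × MSTD A₂' ×
     (∀ x → x ∈ A₁' → x ∉ A₂') ×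
     (∀ x → (x ∈ A₁' ⊎ x ∈ A₂') ⇔ InI x (+ 1) (+ 2 * n + m + + 4 * k + + 4))
theorem1p1 n 0<n A₁ A₂ L₁ R₁ L₂ R₂ MSTD₁ MSTD₂ P₁ P₂ apart A-cover A₁⇔ A₂⇔
  L₁-bounds R₁-bounds L₂-bounds R₂-bounds
  L₁-first n∈L₁ n+1∈R₁ R₁-last L₂-first R₂-last k m n+4≤2k _ M₁ M₂ M₁-bounds M₂-bounds
  (t , xs , pairs , x-steps , x₀-bounds , xₜ-bounds) (s , ys , triples , y-steps , y₀-bounds , yₛ-bounds)
  M-apart M-cover =
  -- The result for `thin` and `thick` is carried over to the intervals of the statement.
  subst₂ Result
    (cong₂ (λ O O′ → L₁ ++ O ++ M₁ ++ O′ ++ shift R₁ (m + + 4 * k + + 4)) O₁₁≡ O₁₂≡)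
    (cong₂ (λ O O′ → L₂ ++ O ++ M₂ ++ O′ ++ shift R₂ (m + + 4 * k + + 4)) O₂₁≡ O₂₂≡)
    ( E.A₁′-MSTD (xs 0) (xs t)
        (window-chain xs t (λ j j≤t → pair-block (proj₁ (pairs j j≤t)) (proj₂ (pairs j j≤t)))
          (λ j j<t → x-step (xs j) (xs (suc j)) (proj₂ (x-steps j j<t))))
        (x-start (xs 0) (proj₂ (proj₂ x₀-bounds))) (x-end (xs t) (proj₁ (proj₁ xₜ-bounds))) MSTD₁
    , E.A₂′-MSTD (ys 0) (ys s)
        (window-chain ys s (λ j j≤s → triple-block (proj₁ (triples j j≤s)) (proj₁ (proj₂ (triples j j≤s)))
                                        (proj₂ (proj₂ (triples j j≤s))))
          (λ j j<s → y-step (ys j) (ys (suc j)) (proj₂ (y-steps j j<s))))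
        (y-start (ys 0) (proj₂ (proj₂ y₀-bounds))) (y-end (ys s) (proj₁ (proj₁ yₛ-bounds))) MSTD₂
    , (λ x → disjoint E.A′-part)
    , (λ x → mk⇔ (widen x ∘ [ left E.A′-part , right E.A′-part ]′) (cover E.A′-part x ∘ narrow x)))
  where
  Result : ZSet → ZSet → Set
  Result X Y = MSTD X × MSTD Y × (∀ x → x ∈ X → x ∉ Y) ×
    (∀ x → (x ∈ X ⊎ x ∈ Y) ⇔ InI x (+ 1) (+ 2 * n + m + + 4 * k + + 4))

  0≤n : + 0 ≤ n
  0≤n = <⇒≤ 0<n

  L×R-part = halves 0≤n apart A-cover A₁⇔ A₂⇔ L₁-bounds R₁-bounds L₂-bounds R₂-bounds

  M-widen : ∀ x → InI x (n + + 2 * k + + 6) (n + m + + 2 * k - + 1) →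
    InI x (n + (k - + 2 + (k - + 2)) + + 10) (n + (m + + 4 * k + + 4) - (k - + 2 + (k - + 2)) - + 9)
  M-widen x (lo , hi) =
    lin 0 lo (solve (x ∷ n ∷ k ∷ [])) , lin 0 hi (solve (x ∷ n ∷ k ∷ m ∷ []))

  M-narrow : ∀ x →
    InI x (n + (k - + 2 + (k - + 2)) + + 10) (n + (m + + 4 * k + + 4) - (k - + 2 + (k - + 2)) - + 9) →
    InI x (n + + 2 * k + + 6) (n + m + + 2 * k - + 1)
  M-narrow x (lo , hi) =
    lin 0 lo (solve (x ∷ n ∷ k ∷ [])) , lin 0 hi (solve (x ∷ n ∷ k ∷ m ∷ []))

  M-part : Partition M₁ M₂ (n + (k - + 2 + (k - + 2)) + + 10)
    (n + (m + + 4 * k + + 4) - (k - + 2 + (k - + 2)) - + 9)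
  M-part = record
    { left = λ {x} → M-widen x ∘ M₁-bounds x
    ; right = λ {x} → M-widen x ∘ M₂-bounds x
    ; disjoint = λ {x} → M-apart x
    ; cover = λ x → from (M-cover x) ∘ M-narrow x
    }

  -- Any x in the middle interval forces m ≥ 7, whereas 4e + 18 ≤ S amounts to m ≥ 6. The first
  -- element of the chain in M₁ serves as x.
  long : ∀ x → n + + 2 * k + + 6 ≤ x → x ≤ n + m + + 2 * k - + 1 →
    k - + 2 + (k - + 2) + (k - + 2 + (k - + 2)) + + 18 ≤ m + + 4 * k + + 4
  long x lo hi = lin 1 (lo ⊕ hi) (solve (x ∷ n ∷ k ∷ m ∷ []))

  R₁-last′ : ∀ x → InI x (n + n - + 3) (n + n) → x ∈ R₁
  R₁-last′ x (lo , hi) = R₁-last x (lin 0 lo (solve (x ∷ n ∷ [])) , lin 0 hi (solve (x ∷ n ∷ [])))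

  R₂-last′ : ∀ x → InI x (n + n - + 6) (n + n - + 4) → x ∈ R₂
  R₂-last′ x (lo , hi) = R₂-last x (lin 0 lo (solve (x ∷ n ∷ [])) , lin 0 hi (solve (x ∷ n ∷ [])))

  n≤2e : n ≤ k - + 2 + (k - + 2)
  n≤2e = lin 0 n+4≤2k (solve (n ∷ k ∷ []))

  module E = Expansion n (k - + 2) (m + + 4 * k + + 4) n≤2e
    (long (xs 0) (proj₁ (proj₁ x₀-bounds)) (proj₂ (M₁-bounds (xs 0) (proj₁ (pairs 0 z≤n)))))
    A₁ A₂ L₁ R₁ L₂ R₂ M₁ M₂ P₁ P₂ A₁⇔ A₂⇔ (proj₁ L×R-part) (proj₂ L×R-part) M-part
    L₁-first n∈L₁ n+1∈R₁ R₁-last′ L₂-first R₂-last′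

  x-step : ∀ x y → y - x ≤ + 2 * k - + 1 → y ≤ x + (k - + 2 + (k - + 2) + + 3) + + 1
  x-step x y y-x≤ = lin 1 y-x≤ (solve (x ∷ y ∷ k ∷ []))

  -- The whole first pair lies below the bound, so its start lies one lower, at most n + 4k = n + 4e
  -- + 8. For triples the start is two lower.
  x-start : ∀ x → x + + 1 ≤ n + + 4 * k + + 1 →
    x ≤ n + (k - + 2 + (k - + 2)) + (k - + 2 + (k - + 2)) + + 8
  x-start x x+1≤ = lin 0 x+1≤ (solve (x ∷ n ∷ k ∷ []))

  x-end : ∀ x → n + m + + 4 ≤ x →
    n + (m + + 4 * k + + 4) - (k - + 2 + (k - + 2)) - (k - + 2 + (k - + 2)) - + 8 ≤ x
  x-end x ≤x = lin 0 ≤x (solve (x ∷ n ∷ k ∷ m ∷ []))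

  y-step : ∀ x y → y - x ≤ + 2 * k + + 5 → y ≤ x + (k - + 2 + (k - + 2) + + 10) + + 1
  y-step x y y-x≤ = lin 2 y-x≤ (solve (x ∷ y ∷ k ∷ []))

  y-start : ∀ y → y + + 2 ≤ n + + 4 * k + + 5 →
    y ≤ n + (k - + 2 + (k - + 2)) + (k - + 2 + (k - + 2)) + + 11
  y-start y y+2≤ = lin 0 y+2≤ (solve (y ∷ n ∷ k ∷ []))

  y-end : ∀ y → n + m ≤ y →
    n + (m + + 4 * k + + 4) - (k - + 2 + (k - + 2)) - (k - + 2 + (k - + 2)) - + 12 ≤ y
  y-end y ≤y = lin 0 ≤y (solve (y ∷ n ∷ k ∷ m ∷ []))

  widen : ∀ x → InI x (+ 1) (n + n + (m + + 4 * k + + 4)) → InI x (+ 1) (+ 2 * n + m + + 4 * k + + 4)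
  widen x (lo , hi) = lo , lin 0 hi (solve (x ∷ n ∷ k ∷ m ∷ []))

  narrow : ∀ x → InI x (+ 1) (+ 2 * n + m + + 4 * k + + 4) → InI x (+ 1) (n + n + (m + + 4 * k + + 4))
  narrow x (lo , hi) = lo , lin 0 hi (solve (x ∷ n ∷ k ∷ m ∷ []))

  O₁₁≡ : thin (n + + 4) (k - + 2) ≡ interval (n + + 4) (n + + 4)
    ++ interval2 (n + + 5) (n + + 2 * k + + 1) ++ interval (n + + 2 * k + + 2) (n + + 2 * k + + 2)
  O₁₁≡ = thin-≡ (n + + 4) (k - + 2) (n + + 5) (n + + 2 * k + + 1) (n + + 2 * k + + 2)
    (solve (n ∷ [])) (solve (n ∷ k ∷ [])) (solve (n ∷ k ∷ []))

  q≡ : n + (m + + 4 * k + + 4) - (k - + 2 + (k - + 2)) - + 5 ≡ n + m + + 2 * k + + 3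
  q≡ = solve (n ∷ k ∷ m ∷ [])

  O₁₂≡ : thin (n + (m + + 4 * k + + 4) - (k - + 2 + (k - + 2)) - + 5) (k - + 2) ≡
    interval (n + m + + 2 * k + + 3) (n + m + + 2 * k + + 3)
    ++ interval2 (n + m + + 2 * k + + 4) (n + m + + 4 * k)
    ++ interval (n + m + + 4 * k + + 1) (n + m + + 4 * k + + 1)
  O₁₂≡ = trans (cong (λ q → thin q (k - + 2)) q≡)
    (thin-≡ (n + m + + 2 * k + + 3) (k - + 2) (n + m + + 2 * k + + 4) (n + m + + 4 * k)
      (n + m + + 4 * k + + 1) (solve (n ∷ k ∷ m ∷ [])) (solve (n ∷ k ∷ m ∷ [])) (solve (n ∷ k ∷ m ∷ [])))

  O₂₁≡ : thick (n + + 4) (k - + 2) ≡ interval (n + + 1) (n + + 3)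
    ++ interval2 (n + + 6) (n + + 2 * k) ++ interval (n + + 2 * k + + 3) (n + + 2 * k + + 5)
  O₂₁≡ = thick-≡ (n + + 4) (k - + 2) (n + + 1) (n + + 3) (n + + 6) (n + + 2 * k)
    (n + + 2 * k + + 3) (n + + 2 * k + + 5)
    (solve (n ∷ [])) (solve (n ∷ [])) (solve (n ∷ [])) (solve (n ∷ k ∷ []))
    (solve (n ∷ k ∷ [])) (solve (n ∷ k ∷ []))

  O₂₂≡ : thick (n + (m + + 4 * k + + 4) - (k - + 2 + (k - + 2)) - + 5) (k - + 2) ≡
    interval (n + m + + 2 * k) (n + m + + 2 * k + + 2)
    ++ interval2 (n + m + + 2 * k + + 5) (n + m + + 4 * k - + 1)
    ++ interval (n + m + + 4 * k + + 2) (n + m + + 4 * k + + 4)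
  O₂₂≡ = trans (cong (λ q → thick q (k - + 2)) q≡)
    (thick-≡ (n + m + + 2 * k + + 3) (k - + 2) (n + m + + 2 * k) (n + m + + 2 * k + + 2)
      (n + m + + 2 * k + + 5) (n + m + + 4 * k - + 1) (n + m + + 4 * k + + 2) (n + m + + 4 * k + + 4)
      (solve (n ∷ k ∷ m ∷ [])) (solve (n ∷ k ∷ m ∷ [])) (solve (n ∷ k ∷ m ∷ []))
      (solve (n ∷ k ∷ m ∷ [])) (solve (n ∷ k ∷ m ∷ [])) (solve (n ∷ k ∷ m ∷ [])))
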